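{- For every triple of positive integers $k,\ell,r$ with $k\geq 3$ and $r\geq 3$, there exists a positive integer $N=N(k,\ell,r)$ such that for every integer $n\geq N$: (i) if $k<r$, then $rx_{k,\ell}(K_{r\times n})=k$; (ii) if $k\geq r$ and $\ell\leq \dfrac{\binom{r}{2}\lceil k/r\rceil^{2}}{\lfloor k/r\rfloor}$, then $rx_{k,\ell}(K_{r\times n})\in\{k,k+1\}$; (iii) if $k\geq r$ and $\ell> \dfrac{\binom{r}{2}\lceil k/r\rceil^{2}}{\lfloor k/r\rfloor}$, then $rx_{k,\ell}(K_{r\times n})=k+1$.
   Context: All graphs are undirected, finite and simple. $K_{r\times n}$ is the complete multipartite graph with $r$ vertex classes, each of size $n$. An edge-coloring of a graph $G$ with $t$ colors is any map $c:E(G)\to\{1,\dots,t\}$ (adjacent edges may receive the same color). A tree $T$ that is a subgraph of $G$ is a rainbow tree if no two edges of $T$ have the same color. For $S\subseteq V(G)$, an $S$-tree is a tree in $G$ containing all vertices of $S$, and a rainbow $S$-tree is an $S$-tree that is a rainbow tree. Rainbow $S$-trees $T_1,\dots,T_\ell$ are internally disjoint if $E(T_i)\cap E(T_j)=\emptyset$ and $V(T_i)\cap V(T_j)=S$ for all $1\le i,j\le \ell$ with $i\neq j$. The $(k,\ell)$-rainbow index $rx_{k,\ell}(G)$ is the minimum number of colors needed in an edge-coloring of $G$ such that for every set $S$ of $k$ vertices of $G$ there exist $\ell$ internally disjoint rainbow $S$-trees. -}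

module Defs where

open import Data.Bool using (Bool; T)
open import Data.Fin using (Fin; zero; suc; inject₁; fromℕ; quotient; _≟_)
open import Data.Fin.Subset using (Subset; _∈_; _⊆_; _∩_; ∣_∣; Nonempty)
open import Data.Integer using (+_)
open import Data.Nat using (ℕ; _+_; _*_; _^_; _∸_; _≤_; _/_; NonZero; >-nonZero)
open import Data.Nat.Combinatorics using (_C_)
open import Data.Nat.DivMod using (m≥n⇒m/n>0)
open import Data.Product using (Σ; _×_; ∃-syntax)
open import Data.Rational.Unnormalised as ℚᵘ using (ℚᵘ)
open import Data.Sum using (_⊎_)
open import Function using (_∘_)
open import Function.Definitions using (Injective)
open import Relation.Binary.Construct.Closure.ReflexiveTransitive using (Star)
open import Relation.Binary.PropositionalEquality using (_≡_; _≢_; refl; sym)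
open import Relation.Nullary using (¬_)
open import Relation.Nullary.Decidable using (⌊_⌋; ¬?; toWitness; fromWitness)

record Graph (m : ℕ) : Set where
  field
    adj    : Fin m → Fin m → Bool
    symm   : ∀ {u v} → T (adj u v) → T (adj v u)
    irrefl : ∀ {u} → ¬ T (adj u u)

  _~_ : Fin m → Fin m → Set
  u ~ v = T (adj u v)

-- The vertices Fin (r * n) are split into r consecutive blocks of length n;
-- quotient n u is the block containing u.
K[_×_] : (r n : ℕ) → Graph (r * n)
K[ r × n ] = record
  { adj    = λ u v → ⌊ ¬? (class u ≟ class v) ⌋
  ; symm   = λ u~v → fromWitness (toWitness u~v ∘ sym)
  ; irrefl = λ u~u → toWitness u~u refl
  }
  where
  class : Fin (r * n) → Fin r
  class = quotient n

-- An edge is presented by either of its two orientations, so colour-sym makes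
-- the colour a function of the unordered edge. Non-edges receive no colour.
record EdgeColouring {m : ℕ} (G : Graph m) (t : ℕ) : Set where
  open Graph G
  field
    colour     : ∀ {u v} → u ~ v → Fin t
    colour-sym : ∀ {u v} (e : u ~ v) (e′ : v ~ u) → colour e ≡ colour e′

record Subgraph {m : ℕ} (G : Graph m) : Set where
  open Graph G using (_~_)
  field
    verts     : Subset m
    edge      : Fin m → Fin m → Bool
    edge-sym  : ∀ {u v} → T (edge u v) → T (edge v u)
    edge⇒~    : ∀ {u v} → T (edge u v) → u ~ v
    edge⇒vert : ∀ {u v} → T (edge u v) → u ∈ verts

  _—_ : Fin m → Fin m → Set
  u — v = T (edge u v)

module _ {m : ℕ} {G : Graph m} where
  open Subgraph

  Connected : Subgraph G → Set
  Connected H = Nonempty (verts H) ×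
    (∀ {u v} → u ∈ verts H → v ∈ verts H → Star (_—_ H) u v)

  -- A cycle on 3 + p distinct vertices c 0, …, c (2 + p).
  record Cycle (H : Subgraph G) : Set where
    field
      p         : ℕ
      c         : Fin (3 + p) → Fin m
      injective : Injective _≡_ _≡_ c
      step      : ∀ (i : Fin (2 + p)) → _—_ H (c (inject₁ i)) (c (suc i))
      close     : _—_ H (c (fromℕ (2 + p))) (c zero)

  IsTree : Subgraph G → Set
  IsTree H = Connected H × ¬ Cycle H

  IsRainbow : ∀ {t} → EdgeColouring G t → Subgraph G → Set
  IsRainbow χ H = ∀ {u v x y} (e : _—_ H u v) (f : _—_ H x y) →
    colour (edge⇒~ H e) ≡ colour (edge⇒~ H f) →
    (u ≡ x × v ≡ y) ⊎ (u ≡ y × v ≡ x)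
    where open EdgeColouring χ

  IsRainbowTreeOn : ∀ {t} → EdgeColouring G t → Subset m → Subgraph G → Set
  IsRainbowTreeOn χ S H = IsTree H × S ⊆ verts H × IsRainbow χ H

  InternallyDisjoint : ∀ {ℓ} → Subset m → (Fin ℓ → Subgraph G) → Set
  InternallyDisjoint S H = ∀ i j → i ≢ j →
    (∀ u v → ¬ (_—_ (H i) u v × _—_ (H j) u v)) ×
    verts (H i) ∩ verts (H j) ≡ S

IsRainbowColouring : ∀ {m t} (k ℓ : ℕ) {G : Graph m} → EdgeColouring G t → Set
IsRainbowColouring {m} k ℓ {G} χ = ∀ (S : Subset m) → ∣ S ∣ ≡ k →
  Σ (Fin ℓ → Subgraph G) λ H →
    (∀ i → IsRainbowTreeOn χ S (H i)) × InternallyDisjoint S H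

-- rx_{k,ℓ}(G) is undefined when no number of colours works, so it is
-- given as the relation "rx_{k,ℓ}(G) exists and equals t".
rx[_,_]_≈_ : ∀ {m} (k ℓ : ℕ) → Graph m → ℕ → Set
rx[ k , ℓ ] G ≈ t = Achievable t × (∀ s → Achievable s → t ≤ s)
  where
  Achievable : ℕ → Set
  Achievable s = ∃[ χ ] IsRainbowColouring {t = s} k ℓ {G} χ

⌈_/_⌉ : (a b : ℕ) .{{_ : NonZero b}} → ℕ
⌈ a / b ⌉ = (a + (b ∸ 1)) / b

-- (r choose 2) ⌈k/r⌉² / ⌊k/r⌋; the hypothesis r ≤ k makes ⌊k/r⌋ nonzero.
threshold : (k r : ℕ) .{{_ : NonZero r}} → r ≤ k → ℚᵘ
threshold k r r≤k = + ((r C 2) * ⌈ k / r ⌉ ^ 2) ℚᵘ./ (k / r)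
  where instance
    ⌊k/r⌋≢0 : NonZero (k / r)
    ⌊k/r⌋≢0 = >-nonZero (m≥n⇒m/n>0 r≤k)

-- Upper bounds. Each vertex carries a table of k entries, an entry giving a
-- colour to the vertices that have a prescribed residue and k prescribed digits;
-- the base of the digits is about n ^ (1 / (k² + 1)), so that there are fewer
-- tables than vertices in a class. The colour of u v superposes the value of the
-- table of u at v and that of v at u. Given S, some table gives its k vertices
-- any desired colours, and among the vertices carrying it the residues leave ℓ
-- where the tables of S vanish. For k < r these are the centres of ℓ stars in a
-- class missed by S; in general they are taken in two classes and give ℓ double
-- stars with k + 1 edges, the centre edge using the default colour.
--
-- Lower bounds. A connected rainbow subgraph with t colours has at most t + 1
-- vertices. If S lies in one class, an S-tree has a further vertex. If S is
-- balanced, each of ℓ trees with k colours uses at least ⌊k/r⌋ of the at most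
-- (r choose 2) ⌈k/r⌉² edges inside S. In (ii) the value is found by exhaustive
-- search, since it has to be decided constructively.
module Submission where

open import Defs
open import Data.Bool using (Bool; true; false; T)
import Data.Bool as Bool
open import Data.Bool.Properties using (T?; T-irrelevant)
open import Data.Empty using (⊥)
open import Data.Fin using (Fin; zero; suc; toℕ; fromℕ; fromℕ<; inject₁; inject≤; punchIn; punchOut; combine; remQuot; quotient; remainder; finToFun; funToFin; splitAt; _↑ˡ_; _↑ʳ_; _≟_)
open import Data.Fin.Properties using (any?; all?; suc-injective; toℕ-injective; toℕ-fromℕ<; toℕ-inject≤; toℕ<n; inject≤-injective; punchIn-injective; punchInᵢ≢i; punchOut-injective; splitAt-↑ˡ; splitAt-↑ʳ; remQuot-combine; combine-remQuot; combine-injective; finToFun-funToFin; funToFin-finToFin; injective⇒≤; ¬∀⟶∃¬)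
open import Data.Fin.Subset using (Subset; _∈_; _∉_; _⊆_; _∩_; _∪_; ⁅_⁆; ∣_∣; inside; outside) renaming (⊥ to ∅)
open import Data.Fin.Subset.Properties using (_∈?_; _⊆?_; nonempty?; ⊆-antisym; p⊆q⇒∣p∣≤∣q∣; ∣p∣≤n; ∉⊥; ∣⊥∣≡0; x∈⁅x⁆; x∈⁅y⁆⇒x≡y; ∣⁅x⁆∣≡1; ∪-identityʳ; x∈p∪q⁺; x∈p∪q⁻; x∈p∩q⁺; x∈p∩q⁻)
open import Data.Integer using (+_)
import Data.Integer as ℤ
import Data.Integer.Properties as ℤ
open import Data.Nat using (ℕ; zero; suc; pred; _+_; _*_; _^_; _∸_; _/_; _%_; _≤_; _<_; _≥_; _>_; _≤?_; _<?_; z≤n; s≤s; s≤s⁻¹; NonZero; >-nonZero; >-nonZero⁻¹)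
import Data.Nat as ℕ
open import Data.Nat.Combinatorics using (_C_; nC1≡n; nCk+nC[k+1]≡[n+1]C[k+1])
open import Data.Nat.Divisibility using (∣-refl; n∣m*n)
open import Data.Nat.DivMod using (m%n<n; m≡m%n+[m/n]*n; m/n≤m; m/n*n≤m; /-monoˡ-≤; m*n/n≡m; m<n⇒m/n≡0; m<n⇒m%n≡m; [m+kn]%n≡m%n; n/n≡1; +-distrib-/-∣ʳ; m≥n⇒m/n>0)
import Data.Nat.Properties as ℕ
open import Data.Nat.Tactic.RingSolver using (solve-∀)
open import Data.Product using (Σ; _×_; _,_; proj₁; proj₂; ∃; ∃₂; ∃-syntax; uncurry)
open import Data.Rational.Unnormalised as ℚᵘ using (*<*)
open import Data.Sum using (_⊎_; inj₁; inj₂; [_,_]′; swap)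
open import Data.Unit using (tt)
open import Data.Vec using (Vec; []; _∷_; here; there; tabulate; lookup)
open import Data.Vec.Properties using (lookup∘tabulate; lookup⇒[]=; []=⇒lookup; ≡-dec)
open import Function using (_∘_; id)
open import Function.Definitions using (Injective)
open import Relation.Binary.Construct.Closure.ReflexiveTransitive as Star using (Star; ε; reverse; _◅_; _◅◅_)
open import Relation.Binary.PropositionalEquality using (_≡_; _≢_; refl; sym; trans; cong; cong₂; subst; subst₂; module ≡-Reasoning)
open import Relation.Nullary using (¬_; Dec; yes; no; contradiction)
open import Relation.Nullary.Decidable using (⌊_⌋; toWitness; fromWitness; map′; ¬?; _×-dec_; _⊎-dec_; _→-dec_; decidable-stable)

-- Finite sets and injections

subsetOf : ∀ {m} {P : Fin m → Set} → (∀ v → Dec (P v)) → Subset m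
subsetOf P? = tabulate λ v → ⌊ P? v ⌋

∈-subsetOf⁺ : ∀ {m} {P : Fin m → Set} (P? : ∀ v → Dec (P v)) {v} → P v → v ∈ subsetOf P?
∈-subsetOf⁺ P? {v} p = lookup⇒[]= v _ (trans (lookup∘tabulate _ v) eq)
  where
  eq : ⌊ P? v ⌋ ≡ true
  eq with P? v
  ... | yes _ = refl
  ... | no ¬p = contradiction p ¬p

∈-subsetOf⁻ : ∀ {m} {P : Fin m → Set} (P? : ∀ v → Dec (P v)) {v} → v ∈ subsetOf P? → P v
∈-subsetOf⁻ P? {v} v∈ = toWitness {a? = P? v} (subst T (sym (trans (sym (lookup∘tabulate _ v)) ([]=⇒lookup v∈))) tt)

element : ∀ {m} (S : Subset m) → Fin ∣ S ∣ → Fin m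
element (inside  ∷ S) zero    = zero
element (inside  ∷ S) (suc i) = suc (element S i)
element (outside ∷ S) i       = suc (element S i)

element-∈ : ∀ {m} (S : Subset m) i → element S i ∈ S
element-∈ (inside  ∷ S) zero    = here
element-∈ (inside  ∷ S) (suc i) = there (element-∈ S i)
element-∈ (outside ∷ S) i       = there (element-∈ S i)

element-injective : ∀ {m} (S : Subset m) → Injective _≡_ _≡_ (element S)
element-injective (inside  ∷ S) {zero}  {zero}  _  = refl
element-injective (inside  ∷ S) {suc i} {suc j} eq = cong suc (element-injective S (suc-injective eq))
element-injective (outside ∷ S) eq = element-injective S (suc-injective eq)

element-surjective : ∀ {m} (S : Subset m) {v} → v ∈ S → ∃[ i ] element S i ≡ v
element-surjective (inside  ∷ S) here = zero , refl
element-surjective (inside  ∷ S) (there v∈S) with i , refl ← element-surjective S v∈S = suc i , refl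
element-surjective (outside ∷ S) (there v∈S) with i , refl ← element-surjective S v∈S = i , refl

injection⇒≤∣∣ : ∀ {m a} (S : Subset m) (f : Fin a → Fin m) → Injective _≡_ _≡_ f →
  (∀ i → f i ∈ S) → a ≤ ∣ S ∣
injection⇒≤∣∣ S f f-inj f∈S = injective⇒≤ {f = λ i → proj₁ (element-surjective S (f∈S i))} λ {i} {j} eq →
  f-inj (trans (sym (proj₂ (element-surjective S (f∈S i))))
        (trans (cong (element S) eq) (proj₂ (element-surjective S (f∈S j)))))

∣p∪⁅x⁆∣≡1+∣p∣ : ∀ {m} (p : Subset m) {x} → x ∉ p → ∣ p ∪ ⁅ x ⁆ ∣ ≡ suc ∣ p ∣
∣p∪⁅x⁆∣≡1+∣p∣ (inside  ∷ p) {zero}  x∉p = contradiction here x∉p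
∣p∪⁅x⁆∣≡1+∣p∣ (outside ∷ p) {zero}  x∉p = cong (suc ∘ ∣_∣) (∪-identityʳ p)
∣p∪⁅x⁆∣≡1+∣p∣ (inside  ∷ p) {suc x} x∉p = cong suc (∣p∪⁅x⁆∣≡1+∣p∣ p (x∉p ∘ there))
∣p∪⁅x⁆∣≡1+∣p∣ (outside ∷ p) {suc x} x∉p = ∣p∪⁅x⁆∣≡1+∣p∣ p (x∉p ∘ there)

removeOne : ∀ {A : Set} {m} (_≟A_ : (x y : A) → Dec (x ≡ y)) (x : A) (g : Fin (suc m) → A) → Injective _≡_ _≡_ g →
  ∃[ h ] Injective _≡_ _≡_ (g ∘ h) × (∀ (j : Fin m) → g (h j) ≢ x)
removeOne _≟A_ x g g-inj with any? (λ i → g i ≟A x)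
... | yes (i , gi≡x) = punchIn i , punchIn-injective i _ _ ∘ g-inj ,
  λ j eq → punchInᵢ≢i i j (g-inj (trans eq (sym gi≡x)))
... | no ∄i = suc , suc-injective ∘ g-inj , λ j eq → ∄i (suc j , eq)

-- An injective `g` takes each forbidden value at most once, so dropping one index per value costs
-- at most `b` of the `b + ℓ` indices.
avoiding : ∀ {A : Set} (_≟A_ : (x y : A) → Dec (x ≡ y)) {b ℓ} (bad : Fin b → A) (g : Fin (b + ℓ) → A) → Injective _≡_ _≡_ g →
  ∃[ h ] Injective _≡_ _≡_ (g ∘ h) × (∀ (j : Fin ℓ) i → g (h j) ≢ bad i)
avoiding _≟A_ {zero}  bad g g-inj = id , g-inj , λ _ ()
avoiding _≟A_ {suc b} bad g g-inj
  with h , gh-inj , gh≢ ← removeOne _≟A_ (bad zero) g g-inj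
  with h′ , inj , avoids ← avoiding _≟A_ (bad ∘ suc) (g ∘ h) gh-inj =
  h ∘ h′ , inj , λ where
    j zero    → gh≢ (h′ j)
    j (suc i) → avoids j i

-- Points outside the image go to the default `i₀`. This lets every vertex carry an address although
-- addresses may be fewer than the vertices of a class.
retraction : ∀ {a b} → Fin a → (f : Fin a → Fin b) → Injective _≡_ _≡_ f → ∃[ g ] (∀ i → g (f i) ≡ i)
retraction {a} {b} i₀ f f-inj = g , g∘f
  where
  g : Fin b → Fin a
  g y with any? (λ i → f i ≟ y)
  ... | yes (i , _) = i
  ... | no _        = i₀
  g∘f : ∀ i → g (f i) ≡ i
  g∘f i with any? (λ j → f j ≟ f i)
  ... | yes (j , eq) = f-inj eq
  ... | no ∄j        = contradiction (i , refl) ∄j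

-- Pigeonhole: if every point were hit, choosing preimages would inject `Fin b` into `Fin a`.
missed : ∀ {a b} → a < b → (f : Fin a → Fin b) → ∃[ y ] (∀ i → f i ≢ y)
missed {a} {b} a<b f with any? (λ y → all? λ i → ¬? (f i ≟ y))
... | yes r = r
... | no ∄y = contradiction (injective⇒≤ {f = proj₁ ∘ hit} λ {y} {z} eq → trans (sym (proj₂ (hit y))) (trans (cong f eq) (proj₂ (hit z)))) (ℕ.<⇒≱ a<b)
  where
  hit : ∀ y → ∃[ i ] f i ≡ y
  hit y with any? (λ i → f i ≟ y)
  ... | yes r = r
  ... | no ∄i = contradiction (y , λ i eq → ∄i (i , eq)) ∄y

-- Digit expansions and integer roots

finToFun-injective : ∀ a b {x y : Fin (a ^ b)} → (∀ i → finToFun {a} {b} x i ≡ finToFun y i) → x ≡ y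
finToFun-injective a b {x} {y} eq = begin
  x                              ≡⟨ funToFin-finToFin {b} x ⟨
  funToFin (finToFun {a} {b} x)  ≡⟨ funToFin-cong eq ⟩
  funToFin (finToFun {a} {b} y)  ≡⟨ funToFin-finToFin {b} y ⟩
  y                              ∎
  where
  open ≡-Reasoning
  funToFin-cong : ∀ {m n} {f g : Fin m → Fin n} → (∀ i → f i ≡ g i) → funToFin f ≡ funToFin g
  funToFin-cong {zero}  _  = refl
  funToFin-cong {suc m} eq = cong₂ combine (eq zero) (funToFin-cong (eq ∘ suc))

differingDigit : ∀ a b {x y : Fin (a ^ b)} → x ≢ y → ∃[ i ] finToFun {a} {b} x i ≢ finToFun y i
differingDigit a b x≢y = ¬∀⟶∃¬ b _ (λ i → finToFun _ i ≟ finToFun _ i) (x≢y ∘ finToFun-injective a b)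

-- The integer `d`-th root of `n`, by induction on the excess of `n` over `b₀ ^ d`: when `n` grows
-- by one, the root stays or moves up by one.
rootBelow : ∀ d .{{_ : NonZero d}} b₀ n → b₀ ^ d ≤ n → ∃[ b ] b₀ ≤ b × b ^ d ≤ n × n < suc b ^ d
rootBelow d b₀ n lo with ℕ.m≤n⇒∃[o]m+o≡n lo
... | o , refl = go o
  where
  go : ∀ o → ∃[ b ] b₀ ≤ b × b ^ d ≤ b₀ ^ d + o × b₀ ^ d + o < suc b ^ d
  go zero = b₀ , ℕ.≤-refl , ℕ.m≤m+n _ 0 , subst (_< suc b₀ ^ d) (sym (ℕ.+-identityʳ _)) (ℕ.^-monoˡ-< d (ℕ.n<1+n b₀))
  go (suc o) with go o
  ... | b , b₀≤b , below , above with suc (b₀ ^ d + o) <? suc b ^ d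
  ...   | yes above′ = b , b₀≤b , ℕ.≤-trans below (ℕ.+-monoʳ-≤ _ (ℕ.n≤1+n o)) , subst (_< suc b ^ d) (sym (ℕ.+-suc _ o)) above′
  ...   | no ¬above′ = suc b , ℕ.m≤n⇒m≤1+n b₀≤b , subst (suc b ^ d ≤_) (sym (ℕ.+-suc _ o)) (ℕ.≮⇒≥ ¬above′) ,
          ℕ.≤-<-trans (subst (_≤ suc b ^ d) (sym (ℕ.+-suc _ o)) above) (ℕ.^-monoˡ-< d (ℕ.n<1+n (suc b)))

-- A colouring with many rainbow centres

-- Only the unit law and commutativity matter; suc a ⊕ suc b is arbitrary.
_⊕_ : ∀ {t} → Fin (suc t) → Fin (suc t) → Fin (suc t)
zero  ⊕ b     = b
suc a ⊕ zero  = suc a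
suc a ⊕ suc b = zero

⊕-comm : ∀ {t} (a b : Fin (suc t)) → a ⊕ b ≡ b ⊕ a
⊕-comm zero    zero    = refl
⊕-comm zero    (suc b) = refl
⊕-comm (suc a) zero    = refl
⊕-comm (suc a) (suc b) = refl

⊕-identityʳ : ∀ {t} (a : Fin (suc t)) → a ⊕ zero ≡ a
⊕-identityʳ a = ⊕-comm a zero

-- Candidate centres for ℓ trees, in every class. `hub-inj` compares different classes too, which
-- keeps the trees disjoint when they use two hubs each; `col-hub-hub` reserves the default colour
-- for an edge between the two.
record Hubs {k t} (ℓ r n : ℕ) (φ : Fin k → Fin (suc t))
            (col : Fin (r * n) → Fin (r * n) → Fin (suc t)) (s : Fin k → Fin (r * n)) : Set where
  field
    hub         : Fin r → Fin ℓ → Fin (r * n)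
    class-hub   : ∀ i q → quotient n (hub i q) ≡ i
    hub-inj     : ∀ i j {q q′} → hub i q ≡ hub j q′ → q ≡ q′
    hub≢s       : ∀ i q j → hub i q ≢ s j
    col-hub-s   : ∀ i q j → col (hub i q) (s j) ≡ φ j
    col-hub-hub : ∀ i j q → col (hub i q) (hub j q) ≡ zero

-- A code is a table of `k` entries packed into one number. An entry consists of a residue below `M`
-- and `k` tests, each naming one of `D` digit positions and the value in base `B` expected there.
module Codes (k M D B : ℕ) where

  tests : ℕ
  tests = (D * B) ^ k

  codes : ℕ
  codes = (M * tests) ^ k

  residue : Fin codes → Fin k → Fin M
  residue c i = quotient tests (finToFun {M * tests} {k} c i)

  test : Fin codes → Fin k → Fin k → Fin D × Fin B
  test c i j = remQuot B (finToFun {D * B} {k} (remainder {M} tests (finToFun {M * tests} {k} c i)) j)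

  encode : (res : Fin k → Fin M) (tst : Fin k → Fin k → Fin D × Fin B) →
    ∃[ c ] (∀ i → residue c i ≡ res i) × (∀ i j → test c i j ≡ tst i j)
  encode res tst = funToFin entry , (λ i → cong proj₁ (decoded i)) , λ i j →
    trans (cong (λ x → remQuot B (finToFun {D * B} {k} (proj₂ x) j)) (decoded i))
    (trans (cong (remQuot B) (finToFun-funToFin (uncurry combine ∘ tst i) j))
           (remQuot-combine _ _))
    where
    row : Fin k → Fin tests
    row i = funToFin (uncurry combine ∘ tst i)
    entry : Fin k → Fin (M * tests)
    entry i = combine (res i) (row i)
    decoded : ∀ i → remQuot tests (finToFun {M * tests} {k} (funToFin entry) i) ≡ (res i , row i)
    decoded i = trans (cong (remQuot tests) (finToFun-funToFin entry i)) (remQuot-combine _ _)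

-- A vertex u carries a table of k entries, each recognising a vertex by its
-- residue and by k of its digits. Demanding the residue makes the table of u
-- vanish on all but few residues, so that u v and v u rarely interfere.
module Colour (k ℓ r n D B t : ℕ) (φ : Fin k → Fin (suc t)) (rn≤Bᴰ : r * n ≤ B ^ suc D) where

  -- Room for the `k * k` residues that the tables of the `k` given vertices recognise, the `k`
  -- residues of these vertices themselves, and ℓ residues left for hubs.
  M : ℕ
  M = (k * k + k) + ℓ

  open Codes k M (suc D) B

  digit : Fin (r * n) → Fin (suc D) → Fin B
  digit v = finToFun (inject≤ v rn≤Bᴰ)

  separate : ∀ {u v} → u ≢ v → ∃[ p ] digit u p ≢ digit v p
  separate u≢v = differingDigit B (suc D) (u≢v ∘ inject≤-injective _ _ _ _)

  module _ (address : Fin n → Fin codes × Fin M) where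

    -- Code and residue depend only on the position inside the class, so all classes offer the same
    -- addresses.
    code : Fin (r * n) → Fin codes
    code v = proj₁ (address (remainder {r} n v))

    res : Fin (r * n) → Fin M
    res v = proj₂ (address (remainder {r} n v))

    Recognises : Fin codes → Fin k → Fin (r * n) → Set
    Recognises c i v = res v ≡ residue c i × (∀ j → digit v (proj₁ (test c i j)) ≡ proj₂ (test c i j))

    recognises? : ∀ c i v → Dec (Recognises c i v)
    recognises? c i v = (res v ≟ residue c i) ×-dec all? λ j → digit v (proj₁ (test c i j)) ≟ proj₂ (test c i j)

    table : Fin codes → Fin (r * n) → Fin (suc t)
    table c v with any? (λ i → recognises? c i v)
    ... | yes (i , _) = φ i
    ... | no _        = zero

    col : Fin (r * n) → Fin (r * n) → Fin (suc t)
    col u v = table (code u) v ⊕ table (code v) u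

    col-sym : ∀ u v → col u v ≡ col v u
    col-sym u v = ⊕-comm (table (code u) v) (table (code v) u)

    table-default : ∀ c v → (∀ i → res v ≢ residue c i) → table c v ≡ zero
    table-default c v res≢ with any? (λ i → recognises? c i v)
    ... | yes (i , eq , _) = contradiction eq (res≢ i)
    ... | no _             = refl

    -- Test `j` of entry `i` looks at a digit where `s i` and `s j` differ. Hence entry `i` accepts
    -- `s i` and rejects every other vertex of `s`, and whichever entry the search finds for `s j`
    -- is entry `j`.
    table-for : (s : Fin k → Fin (r * n)) → Injective _≡_ _≡_ s →
      ∃[ c ] (∀ i → residue c i ≡ res (s i)) × (∀ i → table c (s i) ≡ φ i)
    table-for s s-inj = c , residue≡ , table≡
      where
      position : Fin k → Fin k → Fin (suc D)
      position i j with s i ≟ s j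
      -- Here `i` and `j` coincide, so the test compares `s i` with itself and any position will do.
      ... | yes _    = zero
      ... | no si≢sj = proj₁ (separate si≢sj)
      separated : ∀ i j → (∀ p → p ≡ position i j → digit (s j) p ≡ digit (s i) p) → i ≡ j
      separated i j same with s i ≟ s j
      ... | yes si≡sj = s-inj si≡sj
      ... | no si≢sj  = contradiction (sym (same _ refl)) (proj₂ (separate si≢sj))
      encoded = encode (res ∘ s) (λ i j → position i j , digit (s i) (position i j))
      c = proj₁ encoded
      residue≡ = proj₁ (proj₂ encoded)
      test≡ = proj₂ (proj₂ encoded)
      table≡ : ∀ i → table c (s i) ≡ φ i
      table≡ j with any? (λ i → recognises? c i (s j))
      ... | no ∄i = contradiction (j , sym (residue≡ j) , λ j′ → subst (λ pd → digit (s j) (proj₁ pd) ≡ proj₂ pd) (sym (test≡ j j′)) refl) ∄i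
      ... | yes (i , _ , passes) = cong φ (separated i j λ where
              p refl → subst (λ pd → digit (s j) (proj₁ pd) ≡ proj₂ pd) (test≡ i j) (passes j))

    module _ (place : Fin codes → Fin M → Fin n) (address∘place : ∀ c y → address (place c y) ≡ (c , y)) where

      -- Every hub carries the code `c` made for `s`, and its residue avoids `bad`. The tables of
      -- the `s j` therefore vanish at the hub, leaving only the value `φ j` of the table of the
      -- hub. As `c` recognises only residues of `s`, it vanishes at all hubs.
      hubs : (s : Fin k → Fin (r * n)) → Injective _≡_ _≡_ s →
        Hubs ℓ r n φ col s
      hubs s s-inj = record
        { hub         = hub
        ; class-hub   = class-hub
        ; hub-inj     = hub-inj
        ; hub≢s       = λ i q j → res-hub≢ i q j ∘ cong res
        ; col-hub-s   = col-hub-s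
        ; col-hub-hub = λ i j q → cong₂ _⊕_ (table-hub i j q) (table-hub j i q)
        }
        where
        found = table-for s s-inj
        c = proj₁ found
        residue≡ = proj₁ (proj₂ found)
        table≡ = proj₂ (proj₂ found)
        badPair : Fin k × Fin k → Fin M
        badPair (i , j) = residue (code (s i)) j
        badSum : Fin (k * k) ⊎ Fin k → Fin M
        badSum = [ badPair ∘ remQuot k , res ∘ s ]′
        bad : Fin (k * k + k) → Fin M
        bad = badSum ∘ splitAt (k * k)
        bad-table : ∀ i j → ∃[ x ] bad x ≡ residue (code (s i)) j
        bad-table i j = combine i j ↑ˡ k ,
          trans (cong badSum (splitAt-↑ˡ (k * k) (combine i j) k)) (cong badPair (remQuot-combine i j))
        bad-res : ∀ j → ∃[ x ] bad x ≡ res (s j)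
        bad-res j = k * k ↑ʳ j , cong badSum (splitAt-↑ʳ (k * k) k j)
        avoided = avoiding _≟_ bad id id
        residue′ = proj₁ avoided
        avoids = proj₂ (proj₂ avoided)
        hub : Fin r → Fin ℓ → Fin (r * n)
        hub i q = combine i (place c (residue′ q))
        address-hub : ∀ i q → address (remainder {r} n (hub i q)) ≡ (c , residue′ q)
        address-hub i q = trans (cong (address ∘ proj₂) (remQuot-combine i _)) (address∘place c _)
        code-hub : ∀ i q → code (hub i q) ≡ c
        code-hub i q = cong proj₁ (address-hub i q)
        res-hub : ∀ i q → res (hub i q) ≡ residue′ q
        res-hub i q = cong proj₂ (address-hub i q)
        class-hub : ∀ i q → quotient n (hub i q) ≡ i
        class-hub i q = cong proj₁ (remQuot-combine i _)
        hub-inj : ∀ i j {q q′} → hub i q ≡ hub j q′ → q ≡ q′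
        hub-inj i j {q} {q′} eq = proj₁ (proj₂ avoided) (trans (sym (res-hub i q)) (trans (cong res eq) (res-hub j q′)))
        res-hub≢ : ∀ i q j → res (hub i q) ≢ res (s j)
        res-hub≢ i q j eq with x , bx ← bad-res j = avoids q x (trans (sym (res-hub i q)) (trans eq (sym bx)))
        col-hub-s : ∀ i q j → col (hub i q) (s j) ≡ φ j
        col-hub-s i q j = trans (cong₂ _⊕_ (trans (cong (λ c → table c (s j)) (code-hub i q)) (table≡ j))
          (table-default (code (s j)) (hub i q) λ j′ eq → let x , bx = bad-table j j′ in
             avoids q x (trans (sym (res-hub i q)) (trans eq (sym bx))))) (⊕-identityʳ (φ j))
        table-hub : ∀ i j q → table (code (hub i q)) (hub j q) ≡ zero
        table-hub i j q = trans (cong (λ c → table c (hub j q)) (code-hub i q))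
          (table-default c (hub j q) λ j′ eq → res-hub≢ j q j′ (trans eq (residue≡ j′)))

-- Fitting the codes into a vertex class

^-distribʳ-* : ∀ k a b → (a * b) ^ k ≡ a ^ k * b ^ k
^-distribʳ-* zero    a b = refl
^-distribʳ-* (suc k) a b = trans (cong (a * b *_) (^-distribʳ-* k a b)) (exchange a b (a ^ k) (b ^ k))
  where
  exchange : ∀ x y z w → x * y * (z * w) ≡ x * z * (y * w)
  exchange = solve-∀

-- There are `k * k` tests in a code, so a factor `b` in the base enters the count with exponent
-- `k * k`. This is less than the number of digits `suc (k * k)`, and one spare power of `b` can
-- absorb the constant.
codes-scale : ∀ k M a b → ((M * (a * b) ^ k) ^ k) * M ≡ ((M * a ^ k) ^ k * M) * b ^ (k * k)
codes-scale k M a b = begin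
  (M * (a * b) ^ k) ^ k * M            ≡⟨ cong (λ x → (M * x) ^ k * M) (^-distribʳ-* k a b) ⟩
  (M * (a ^ k * b ^ k)) ^ k * M        ≡⟨ cong (λ x → x ^ k * M) (ℕ.*-assoc M (a ^ k) (b ^ k)) ⟨
  (M * a ^ k * b ^ k) ^ k * M          ≡⟨ cong (_* M) (^-distribʳ-* k (M * a ^ k) (b ^ k)) ⟩
  (M * a ^ k) ^ k * (b ^ k) ^ k * M    ≡⟨ cong (λ x → (M * a ^ k) ^ k * x * M) (ℕ.^-*-assoc b k k) ⟩
  (M * a ^ k) ^ k * b ^ (k * k) * M    ≡⟨ *-swap ((M * a ^ k) ^ k) (b ^ (k * k)) M ⟩
  (M * a ^ k) ^ k * M * b ^ (k * k)    ∎
  where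
  open ≡-Reasoning
  *-swap : ∀ x y z → x * y * z ≡ x * z * y
  *-swap = solve-∀

hubColouring : ∀ k ℓ r t .{{_ : NonZero ℓ}} .{{_ : NonZero r}} (φ : Fin k → Fin (suc t)) →
  ∃[ N ] (∀ n → N ≤ n → ∃[ col ] (∀ u v → col u v ≡ col v u) × (∀ s → Injective _≡_ _≡_ s → Hubs ℓ r n φ col s))
-- This bound on `n` makes its integer `d`-th root `b` exceed `K`.
hubColouring k ℓ r t φ = suc K ^ d , build
  where
  d D M K : ℕ
  D = k * k
  d = suc D
  M = (k * k + k) + ℓ
  -- The number of pairs of a code and a residue when the base is `r * 2`, the coefficient of `b` in
  -- the estimate `B≤`.
  K = (M * (d * (r * 2)) ^ k) ^ k * M
  instance
    M≢0 : NonZero M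
    M≢0 = >-nonZero (ℕ.≤-trans (>-nonZero⁻¹ ℓ) (ℕ.m≤n+m ℓ (k * k + k)))
  build : ∀ n → suc K ^ d ≤ n → ∃[ col ] (∀ u v → col u v ≡ col v u) × (∀ s → Injective _≡_ _≡_ s → Hubs ℓ r n φ col s)
  build n N≤n with b , K<b , below , above ← rootBelow d (suc K) n N≤n = col address , col-sym address , hubs address place address∘place
    where
    open ℕ.≤-Reasoning
    -- Since `n` is below `suc b ^ d`, the factor `r` is enough for `d` digits in base `B` to tell
    -- all `r * n` vertices apart.
    B : ℕ
    B = r * suc b
    B≢0 : NonZero B
    B≢0 = ℕ.m*n≢0 r (suc b)
    rn≤Bᵈ : r * n ≤ B ^ d
    rn≤Bᵈ = begin
      r * n              ≤⟨ ℕ.*-mono-≤ (ℕ.m≤m*n r (r ^ D) {{ℕ.m^n≢0 r D}}) (ℕ.<⇒≤ above) ⟩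
      r ^ d * suc b ^ d  ≡⟨ ^-distribʳ-* d r (suc b) ⟨
      B ^ d              ∎
    open Codes k M d B
    open Colour k ℓ r n D B t φ rn≤Bᵈ hiding (M)
    B≤ : B ≤ r * 2 * b
    B≤ = begin
      r * suc b    ≤⟨ ℕ.*-monoʳ-≤ r (ℕ.+-monoˡ-≤ b (ℕ.≤-trans (s≤s z≤n) K<b)) ⟩
      r * (b + b)  ≡⟨ double r b ⟩
      r * 2 * b    ∎
      where
      double : ∀ x y → x * (y + y) ≡ x * 2 * y
      double = solve-∀
    size : codes * M ≤ n
    size = begin
      (M * (d * B) ^ k) ^ k * M                ≤⟨ ℕ.*-monoˡ-≤ M (ℕ.^-monoˡ-≤ k (ℕ.*-monoʳ-≤ M (ℕ.^-monoˡ-≤ k (ℕ.*-monoʳ-≤ d B≤)))) ⟩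
      (M * (d * (r * 2 * b)) ^ k) ^ k * M      ≡⟨ cong (λ x → (M * x ^ k) ^ k * M) (ℕ.*-assoc d (r * 2) b) ⟨
      (M * (d * (r * 2) * b) ^ k) ^ k * M      ≡⟨ codes-scale k M (d * (r * 2)) b ⟩
      K * b ^ D                                ≤⟨ ℕ.*-monoˡ-≤ (b ^ D) (ℕ.<⇒≤ K<b) ⟩
      b ^ d                                    ≤⟨ below ⟩
      n                                        ∎
    codes*M≢0 : NonZero (codes * M)
    codes*M≢0 = ℕ.m*n≢0 codes M {{ℕ.m^n≢0 (M * (d * B) ^ k) k {{ℕ.m*n≢0 M ((d * B) ^ k) {{M≢0}} {{ℕ.m^n≢0 (d * B) k {{ℕ.m*n≢0 d B {{_}} {{B≢0}}}}}}}}}}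
    decoding = retraction (fromℕ< (>-nonZero⁻¹ (codes * M) {{codes*M≢0}})) (λ x → inject≤ {codes * M} {n} x size) (inject≤-injective _ _ _ _)
    address : Fin n → Fin codes × Fin M
    address = remQuot M ∘ proj₁ decoding
    place : Fin codes → Fin M → Fin n
    place c y = inject≤ (combine c y) size
    address∘place : ∀ c y → address (place c y) ≡ (c , y)
    address∘place c y = trans (cong (remQuot M) (proj₂ decoding (combine c y))) (remQuot-combine c y)

-- Stars and double stars

colouring : ∀ {m t} (G : Graph m) (col : Fin m → Fin m → Fin t) → (∀ u v → col u v ≡ col v u) → EdgeColouring G t
colouring G col col-sym = record { colour = λ {u} {v} _ → col u v ; colour-sym = λ {u} {v} _ _ → col-sym u v }

-- The tree with root w in which each u ∈ L is joined to att u. It is a star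
-- with centre w, or a double star with centres w and w′.
record Attachment {m} (G : Graph m) : Set where
  open Graph G
  field
    L     : Subset m
    w w′  : Fin m
    att   : Fin m → Fin m
    adj-att : ∀ {u} → u ∈ L → u ~ att u
    w∉L   : w ∉ L
    shape : ∀ {u} → u ∈ L → att u ≡ w ⊎ (att u ≡ w′ × w′ ∈ L × att w′ ≡ w)

  Joined : Fin m → Fin m → Set
  Joined u v = (u ∈ L × att u ≡ v) ⊎ (v ∈ L × att v ≡ u)

  joined? : ∀ u v → Dec (Joined u v)
  joined? u v = ((u ∈? L) ×-dec (att u ≟ v)) ⊎-dec ((v ∈? L) ×-dec (att v ≟ u))

  att-∈ : ∀ {u} → u ∈ L → att u ∈ L ∪ ⁅ w ⁆
  att-∈ u∈L with shape u∈L
  ... | inj₁ eq            = x∈p∪q⁺ (inj₂ (subst (_∈ ⁅ w ⁆) (sym eq) (x∈⁅x⁆ w)))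
  ... | inj₂ (eq , w′∈ , _) = x∈p∪q⁺ (inj₁ (subst (_∈ L) (sym eq) w′∈))

  tree : Subgraph G
  tree = record
    { verts     = L ∪ ⁅ w ⁆
    ; edge      = λ u v → ⌊ joined? u v ⌋
    ; edge-sym  = λ {u} {v} e → fromWitness {a? = joined? v u} (swap (toWitness {a? = joined? u v} e))
    ; edge⇒~    = λ {u} {v} → joined⇒~ ∘ toWitness {a? = joined? u v}
    ; edge⇒vert = λ {u} {v} → joined⇒∈ ∘ toWitness {a? = joined? u v}
    }
    where
    joined⇒~ : ∀ {u v} → Joined u v → u ~ v
    joined⇒~ (inj₁ (u∈L , refl)) = adj-att u∈L
    joined⇒~ (inj₂ (v∈L , refl)) = symm (adj-att v∈L)
    joined⇒∈ : ∀ {u v} → Joined u v → u ∈ L ∪ ⁅ w ⁆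
    joined⇒∈ (inj₁ (u∈L , _))    = x∈p∪q⁺ (inj₁ u∈L)
    joined⇒∈ (inj₂ (v∈L , refl)) = att-∈ v∈L

  open Subgraph tree using (_—_; edge-sym; verts)

  joined⁻ : ∀ {u v} → u — v → Joined u v
  joined⁻ {u} {v} = toWitness {a? = joined? u v}

  to-att : ∀ {u} → u ∈ L → u — att u
  to-att u∈L = fromWitness {a? = joined? _ _} (inj₁ (u∈L , refl))

  walk-to-w : ∀ {u} → u ∈ verts → Star _—_ u w
  walk-to-w {u} u∈ with x∈p∪q⁻ L ⁅ w ⁆ u∈
  ... | inj₂ u∈⁅w⁆ rewrite x∈⁅y⁆⇒x≡y w u∈⁅w⁆ = ε
  ... | inj₁ u∈L with shape u∈L
  ...   | inj₁ att≡w = subst (u —_) att≡w (to-att u∈L) ◅ ε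
  ...   | inj₂ (att≡w′ , w′∈L , att-w′≡w) = subst (u —_) att≡w′ (to-att u∈L) ◅ subst (w′ —_) att-w′≡w (to-att w′∈L) ◅ ε

  tree-connected : Connected tree
  tree-connected = (w , x∈p∪q⁺ (inj₂ (x∈⁅x⁆ w))) , λ u∈ v∈ → walk-to-w u∈ ◅◅ reverse (λ {u} {v} → edge-sym {u} {v}) (walk-to-w v∈)

  -- Of two distinct neighbours of `v`, at most one is `att v`; the other is attached to `v`, and
  -- `att` only takes the values `w` and `w′` on `L`.
  branching : ∀ {v x y} → v — x → v — y → x ≢ y → v ≡ w ⊎ v ≡ w′
  branching {v} {x} {y} vx vy x≢y with joined⁻ {v} {x} vx | joined⁻ {v} {y} vy
  ... | inj₁ (_ , refl)   | inj₁ (_ , refl) = contradiction refl x≢y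
  ... | inj₂ (x∈L , refl) | _ = [ inj₁ , inj₂ ∘ proj₁ ]′ (shape x∈L)
  ... | inj₁ _ | inj₂ (y∈L , refl) = [ inj₁ , inj₂ ∘ proj₁ ]′ (shape y∈L)

  -- Three consecutive vertices of a cycle would all be branching, but only `w` and `w′` can be.
  tree-acyclic : ¬ Cycle tree
  tree-acyclic cyc = absurd (branching 0—1 (edge-sym {c _} {c _} close) (λ eq → case-01 (injective eq)))
                            (branching (edge-sym {c _} {c _} 0—1) 1—2 λ eq → 0≢2 (injective eq))
                            (2-branching p c step close injective)
    where
    open Cycle cyc
    0—1 = step zero
    1—2 = step (suc zero)
    0≢2 : zero ≢ suc (suc zero)
    0≢2 ()
    case-01 : suc zero ≢ suc (suc (fromℕ p))
    case-01 ()
    -- The successor of the third vertex is `c zero` in a triangle and the fourth vertex otherwise,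
    -- whence the split on `p`.
    2-branching : ∀ p (c : Fin (3 + p) → Fin m) → (∀ i → c (inject₁ i) — c (suc i)) → c (fromℕ (2 + p)) — c zero →
      (∀ {i j} → c i ≡ c j → i ≡ j) → c (suc (suc zero)) ≡ w ⊎ c (suc (suc zero)) ≡ w′
    2-branching zero    c step close inj = branching (edge-sym {c _} {c _} (step (suc zero))) close λ eq → contradiction (inj eq) λ ()
    2-branching (suc p) c step close inj = branching (edge-sym {c _} {c _} (step (suc zero))) (step (suc (suc zero))) λ eq → contradiction (inj eq) λ ()
    distinct : ∀ {i j} {x : Fin m} → i ≢ j → c i ≡ x → c j ≡ x → ∀ {A : Set} → A
    distinct i≢j p q = contradiction (injective (trans p (sym q))) i≢j
    absurd : c zero ≡ w ⊎ c zero ≡ w′ → c (suc zero) ≡ w ⊎ c (suc zero) ≡ w′ → c (suc (suc zero)) ≡ w ⊎ c (suc (suc zero)) ≡ w′ → ⊥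
    absurd (inj₁ a) (inj₁ b) _ = distinct (λ ()) a b
    absurd (inj₂ a) (inj₂ b) _ = distinct (λ ()) a b
    absurd (inj₁ a) (inj₂ _) (inj₁ b) = distinct (λ ()) a b
    absurd (inj₁ _) (inj₂ a) (inj₂ b) = distinct (λ ()) a b
    absurd (inj₂ _) (inj₁ a) (inj₁ b) = distinct (λ ()) a b
    absurd (inj₂ a) (inj₁ _) (inj₂ b) = distinct (λ ()) a b

  -- An edge is determined by its end `u` in `L` whose other end is `att u`, so it suffices to
  -- compare colours over `L`.
  tree-rainbow : ∀ {t} (col : Fin m → Fin m → Fin t) (col-sym : ∀ u v → col u v ≡ col v u) →
    (∀ {u v} → u ∈ L → v ∈ L → col u (att u) ≡ col v (att v) → u ≡ v) → IsRainbow (colouring G col col-sym) tree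
  tree-rainbow col col-sym distinct {u} {v} {x} {y} e f eq with joined⁻ {u} {v} e | joined⁻ {x} {y} f
  ... | inj₁ (u∈ , refl) | inj₁ (x∈ , refl) = inj₁ (u≡x , cong att u≡x)
    where u≡x = distinct u∈ x∈ eq
  ... | inj₁ (u∈ , refl) | inj₂ (y∈ , refl) = inj₂ (u≡y , cong att u≡y)
    where u≡y = distinct u∈ y∈ (trans eq (col-sym x y))
  ... | inj₂ (v∈ , refl) | inj₁ (x∈ , refl) = inj₂ (cong att v≡x , v≡x)
    where v≡x = distinct v∈ x∈ (trans (col-sym v u) eq)
  ... | inj₂ (v∈ , refl) | inj₂ (y∈ , refl) = inj₁ (cong att v≡y , v≡y)
    where v≡y = distinct v∈ y∈ (trans (col-sym v u) (trans eq (col-sym x y)))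

-- Packing stars and double stars in the complete multipartite graph

Achievable : ∀ {m} (k ℓ : ℕ) → Graph m → ℕ → Set
Achievable k ℓ G s = ∃[ χ ] IsRainbowColouring {t = s} k ℓ {G} χ

enumerate : ∀ {m k} (S : Subset m) → ∣ S ∣ ≡ k →
  ∃[ s ] Injective _≡_ _≡_ s × (∀ (i : Fin k) → s i ∈ S) × (∀ {v} → v ∈ S → ∃[ i ] s i ≡ v)
enumerate S refl = element S , element-injective S , element-∈ S , element-surjective S

K-adj⁺ : ∀ r n {u v : Fin (r * n)} → quotient {r} n u ≢ quotient n v → Graph._~_ K[ r × n ] u v
K-adj⁺ r n {u} {v} ≢ = fromWitness {a? = ¬? (quotient {r} n u ≟ quotient n v)} ≢

K-adj⁻ : ∀ r n {u v : Fin (r * n)} → Graph._~_ K[ r × n ] u v → quotient {r} n u ≢ quotient n v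
K-adj⁻ r n {u} {v} = toWitness {a? = ¬? (quotient {r} n u ≟ quotient n v)}

open Attachment using (tree)

-- Since attachments avoid `S`, every edge has an end outside `S`. A common edge would have both
-- ends in `S`.
attachments-disjoint : ∀ {m ℓ} {G : Graph m} (S : Subset m) (A : Fin ℓ → Attachment G) → let open Attachment in
  (∀ q → S ⊆ L (A q)) →
  (∀ q {u} → u ∈ L (A q) → att (A q) u ∉ S) →
  (∀ {q q′ v} → q ≢ q′ → v ∈ Subgraph.verts (tree (A q)) → v ∈ Subgraph.verts (tree (A q′)) → v ∈ S) →
  InternallyDisjoint S (tree ∘ A)
attachments-disjoint {G = G} S A S⊆L att∉S common q q′ q≢q′ =
  (λ u v (e , e′) → edge⊈S e (common q≢q′ (edge⇒vert (tree (A q)) e) (edge⇒vert (tree (A q′)) e′))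
     (common q≢q′ (edge⇒vert (tree (A q)) (edge-sym (tree (A q)) e)) (edge⇒vert (tree (A q′)) (edge-sym (tree (A q′)) e′)))) ,
  ⊆-antisym (λ v∈ → let a , b = x∈p∩q⁻ _ _ v∈ in common q≢q′ a b)
            (λ v∈S → x∈p∩q⁺ (x∈p∪q⁺ (inj₁ (S⊆L q v∈S)) , x∈p∪q⁺ (inj₁ (S⊆L q′ v∈S))))
  where
  open Subgraph
  edge⊈S : ∀ {u v} → T (edge (tree (A q)) u v) → u ∈ S → v ∈ S → ⊥
  edge⊈S {u} {v} e u∈S v∈S with Attachment.joined⁻ (A q) {u} {v} e
  ... | inj₁ (u∈L , refl) = att∉S q u∈L v∈S
  ... | inj₂ (v∈L , refl) = att∉S q v∈L u∈S

module _ (r n : ℕ) where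

  private
    class : Fin (r * n) → Fin r
    class = quotient n

  -- Fewer than `r` vertices miss some class; its hubs are adjacent to all of `S`, and `id` gives
  -- the edges of each star distinct colours.
  achievable-star : ∀ {k ℓ} (col : Fin (r * n) → Fin (r * n) → Fin (suc k)) → (∀ u v → col u v ≡ col v u) →
    (∀ s → Injective _≡_ _≡_ s → Hubs ℓ r n id col s) → suc k < r → Achievable (suc k) ℓ K[ r × n ] (suc k)
  achievable-star {k} {ℓ} col col-sym allHubs k<r = colouring _ col col-sym , packing
    where
    packing : IsRainbowColouring (suc k) ℓ (colouring K[ r × n ] col col-sym)
    packing S ∣S∣≡k with s , s-inj , s∈S , onto ← enumerate S ∣S∣≡k = tree ∘ star ,
      (λ q → (tree-connected (star q) , tree-acyclic (star q)) , (λ v∈S → x∈p∪q⁺ (inj₁ v∈S)) , tree-rainbow (star q) col col-sym (distinct q)) ,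
      attachments-disjoint S star (λ _ → id) (λ q _ → w∉S q) common
      where
      open Attachment using (tree-connected; tree-acyclic; tree-rainbow)
      open Hubs (allHubs s s-inj)
      off = missed k<r (class ∘ s)
      i = proj₁ off
      w∉S : ∀ q → hub i q ∉ S
      w∉S q w∈S with j , eq ← onto w∈S = hub≢s i q j (sym eq)
      star : Fin ℓ → Attachment K[ r × n ]
      star q = record
        { L = S ; w = hub i q ; w′ = hub i q ; att = λ _ → hub i q
        ; adj-att = λ {u} u∈S → K-adj⁺ r n {u} λ eq → let j , sj≡u = onto u∈S in
            proj₂ off j (trans (cong class sj≡u) (trans eq (class-hub i q)))
        ; w∉L = w∉S q
        ; shape = λ _ → inj₁ refl
        }
      distinct : ∀ q {u v} → u ∈ S → v ∈ S → col u (hub i q) ≡ col v (hub i q) → u ≡ v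
      distinct q u∈S v∈S eq with onto u∈S | onto v∈S
      ... | j , refl | j′ , refl = cong s (trans (sym (col-hub-s i q j)) (trans (col-sym _ _) (trans eq (trans (col-sym _ _) (col-hub-s i q j′)))))
      common : ∀ {q q′ v} → q ≢ q′ → v ∈ S ∪ ⁅ hub i q ⁆ → v ∈ S ∪ ⁅ hub i q′ ⁆ → v ∈ S
      common {q} {q′} q≢q′ v∈ v∈′ with x∈p∪q⁻ S _ v∈ | x∈p∪q⁻ S _ v∈′
      ... | inj₁ v∈S | _ = v∈S
      ... | inj₂ _ | inj₁ v∈S = v∈S
      ... | inj₂ v≡ | inj₂ v≡′ = contradiction (hub-inj i i (trans (sym (x∈⁅y⁆⇒x≡y _ v≡)) (x∈⁅y⁆⇒x≡y _ v≡′))) q≢q′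

  -- Vertices of `S` in class `i` hang on the hub in class `i′`, all others on the hub in class `i`.
  -- Taking `suc` for the table colours keeps `zero` free for the edge joining the two hubs.
  achievable-doubleStar : ∀ {k ℓ} (col : Fin (r * n) → Fin (r * n) → Fin (suc k)) → (∀ u v → col u v ≡ col v u) →
    (∀ s → Injective _≡_ _≡_ s → Hubs ℓ r n suc col s) → (i i′ : Fin r) → i ≢ i′ → Achievable k ℓ K[ r × n ] (suc k)
  achievable-doubleStar {k} {ℓ} col col-sym allHubs i i′ i≢i′ = colouring _ col col-sym , packing
    where
    packing : IsRainbowColouring k ℓ (colouring K[ r × n ] col col-sym)
    packing S ∣S∣≡k with s , s-inj , s∈S , onto ← enumerate S ∣S∣≡k = tree ∘ dstar ,
      (λ q → (tree-connected (dstar q) , tree-acyclic (dstar q)) , (λ v∈S → x∈p∪q⁺ (inj₁ (S⊆L q v∈S))) , tree-rainbow (dstar q) col col-sym (distinct q)) ,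
      attachments-disjoint S dstar S⊆L (λ q {u} _ → att∉S q u) common
      where
      open Attachment using (tree-connected; tree-acyclic; tree-rainbow)
      open Hubs (allHubs s s-inj)
      hub∉S : ∀ i q → hub i q ∉ S
      hub∉S i q w∈S with j , eq ← onto w∈S = hub≢s i q j (sym eq)
      L : Fin ℓ → Subset (r * n)
      L q = S ∪ ⁅ hub i′ q ⁆
      S⊆L : ∀ q → S ⊆ L q
      S⊆L q = x∈p∪q⁺ ∘ inj₁
      w′∈L : ∀ q → hub i′ q ∈ L q
      w′∈L q = x∈p∪q⁺ (inj₂ (x∈⁅x⁆ _))
      hub≢hub : ∀ q → hub i q ≢ hub i′ q
      hub≢hub q eq = i≢i′ (trans (sym (class-hub i q)) (trans (cong class eq) (class-hub i′ q)))
      att : Fin ℓ → Fin (r * n) → Fin (r * n)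
      att q u with class u ≟ i
      ... | yes _ = hub i′ q
      ... | no _  = hub i q
      att∉S : ∀ q u → att q u ∉ S
      att∉S q u with class u ≟ i
      ... | yes _ = hub∉S i′ q
      ... | no _  = hub∉S i q
      att-w′ : ∀ q → att q (hub i′ q) ≡ hub i q
      att-w′ q with class (hub i′ q) ≟ i
      ... | yes eq = contradiction (trans (sym eq) (class-hub i′ q)) i≢i′
      ... | no _   = refl
      adjacent : ∀ q u → class u ≢ class (att q u)
      adjacent q u with class u ≟ i
      ... | yes eq = λ eq′ → i≢i′ (trans (sym eq) (trans eq′ (class-hub i′ q)))
      ... | no ≢   = λ eq′ → ≢ (trans eq′ (class-hub i q))
      col-att : ∀ q j → col (s j) (att q (s j)) ≡ suc j
      col-att q j with class (s j) ≟ i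
      ... | yes _ = trans (col-sym _ _) (col-hub-s i′ q j)
      ... | no _  = trans (col-sym _ _) (col-hub-s i q j)
      col-w′ : ∀ q → col (hub i′ q) (att q (hub i′ q)) ≡ zero
      col-w′ q = trans (cong (col _) (att-w′ q)) (col-hub-hub i′ i q)
      dstar : Fin ℓ → Attachment K[ r × n ]
      dstar q = record
        { L = L q ; w = hub i q ; w′ = hub i′ q ; att = att q
        ; adj-att = λ {u} _ → K-adj⁺ r n {u} (adjacent q u)
        ; w∉L = λ w∈L → [ hub∉S i q , hub≢hub q ∘ x∈⁅y⁆⇒x≡y _ ]′ (x∈p∪q⁻ S _ w∈L)
        ; shape = λ {u} _ → shape q u
        }
        where
        shape : ∀ q u → att q u ≡ hub i q ⊎ (att q u ≡ hub i′ q × hub i′ q ∈ L q × att q (hub i′ q) ≡ hub i q)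
        shape q u with class u ≟ i
        ... | yes _ = inj₂ (refl , w′∈L q , att-w′ q)
        ... | no _  = inj₁ refl
      source : ∀ q {u} → u ∈ L q → (∃[ j ] s j ≡ u) ⊎ u ≡ hub i′ q
      source q u∈L = [ inj₁ ∘ onto , inj₂ ∘ x∈⁅y⁆⇒x≡y _ ]′ (x∈p∪q⁻ S _ u∈L)
      distinct : ∀ q {u v} → u ∈ L q → v ∈ L q → col u (att q u) ≡ col v (att q v) → u ≡ v
      distinct q u∈L v∈L eq with source q u∈L | source q v∈L
      ... | inj₁ (j , refl) | inj₁ (j′ , refl) = cong s (suc-injective (trans (sym (col-att q j)) (trans eq (col-att q j′))))
      ... | inj₁ (j , refl) | inj₂ refl = contradiction (trans (sym (col-att q j)) (trans eq (col-w′ q))) λ ()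
      ... | inj₂ refl | inj₁ (j , refl) = contradiction (trans (sym (col-att q j)) (trans (sym eq) (col-w′ q))) λ ()
      ... | inj₂ refl | inj₂ refl = refl
      vertex : ∀ q {v} → v ∈ L q ∪ ⁅ hub i q ⁆ → v ∈ S ⊎ ∃[ i ] v ≡ hub i q
      vertex q v∈ = [ [ inj₁ , (λ x → inj₂ (i′ , x∈⁅y⁆⇒x≡y _ x)) ]′ ∘ x∈p∪q⁻ S _ , (λ x → inj₂ (i , x∈⁅y⁆⇒x≡y _ x)) ]′ (x∈p∪q⁻ (L q) _ v∈)
      common : ∀ {q q′ v} → q ≢ q′ → v ∈ L q ∪ ⁅ hub i q ⁆ → v ∈ L q′ ∪ ⁅ hub i q′ ⁆ → v ∈ S
      common {q} {q′} q≢q′ v∈ v∈′ with vertex q v∈ | vertex q′ v∈′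
      ... | inj₁ v∈S | _ = v∈S
      ... | inj₂ _ | inj₁ v∈S = v∈S
      ... | inj₂ (_ , v≡) | inj₂ (_ , v≡′) = contradiction (hub-inj _ _ (trans (sym v≡) v≡′)) q≢q′

-- Lower bounds

image : ∀ {a m} → (Fin a → Fin m) → Subset m
image f = subsetOf λ v → any? λ i → f i ≟ v

∈-image⁺ : ∀ {a m} (f : Fin a → Fin m) i → f i ∈ image f
∈-image⁺ f i = ∈-subsetOf⁺ (λ v → any? λ i → f i ≟ v) (i , refl)

∈-image⁻ : ∀ {a m} (f : Fin a → Fin m) {v} → v ∈ image f → ∃[ i ] f i ≡ v
∈-image⁻ f = ∈-subsetOf⁻ (λ v → any? λ i → f i ≟ v)

∣image∣ : ∀ {a m} (f : Fin a → Fin m) → Injective _≡_ _≡_ f → ∣ image f ∣ ≡ a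
∣image∣ f f-inj = ℕ.≤-antisym
  (injective⇒≤ {f = proj₁ ∘ preimage} λ {x} {y} eq →
    element-injective (image f) (trans (sym (proj₂ (preimage x))) (trans (cong f eq) (proj₂ (preimage y)))))
  (injection⇒≤∣∣ (image f) f f-inj (∈-image⁺ f))
  where
  preimage : ∀ x → ∃[ i ] f i ≡ element (image f) x
  preimage x = ∈-image⁻ f (element-∈ (image f) x)

crossing : ∀ {m} {R : Fin m → Fin m → Set} (X : Subset m) {u v} → Star R u v → u ∈ X → v ∉ X →
  ∃₂ λ a b → a ∈ X × b ∉ X × R a b
crossing X ε u∈X v∉X = contradiction u∈X v∉X
crossing X (_◅_ {j = b} e walk) u∈X v∉X with b ∈? X
... | yes b∈X = crossing X walk b∈X v∉X
... | no b∉X  = _ , b , u∈X , b∉X , e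

outsider : ∀ {m} (X Y : Subset m) → ∣ X ∣ < ∣ Y ∣ → ∃[ v ] v ∈ Y × v ∉ X
outsider X Y X<Y with any? (λ v → (v ∈? Y) ×-dec ¬? (v ∈? X))
... | yes r = r
... | no ∄v = contradiction (p⊆q⇒∣p∣≤∣q∣ λ {v} v∈Y → decidable-stable (v ∈? X) λ v∉X → ∄v (v , v∈Y , v∉X)) (ℕ.<⇒≱ X<Y)

∪⁅⁆⊆ : ∀ {m} {X Y : Subset m} {v} → X ⊆ Y → v ∈ Y → X ∪ ⁅ v ⁆ ⊆ Y
∪⁅⁆⊆ {X = X} {Y} X⊆Y v∈Y u∈ = [ X⊆Y , (λ u∈⁅v⁆ → subst (_∈ Y) (sym (x∈⁅y⁆⇒x≡y _ u∈⁅v⁆)) v∈Y) ]′ (x∈p∪q⁻ X _ u∈)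

module _ {m t} {G : Graph m} (χ : EdgeColouring G t) (H : Subgraph G) (connected : Connected H) where
  open EdgeColouring χ
  open Subgraph H

  -- A stage of growing the subgraph from a root: `j` further vertices in `X`, and `j` colours each
  -- seen on an edge inside `X`.
  record Grown (j : ℕ) : Set where
    field
      X    : Subset m
      Q    : Subset t
      root : proj₁ (proj₁ connected) ∈ X
      X⊆   : X ⊆ verts
      ∣X∣  : ∣ X ∣ ≡ suc j
      ∣Q∣  : ∣ Q ∣ ≡ j
      used : ∀ {c} → c ∈ Q → ∃₂ λ u v → u ∈ X × v ∈ X × Σ (u — v) λ e → colour (edge⇒~ e) ≡ c

  -- Connectedness supplies an edge leaving `X`. Its colour is new, because the colours in `Q` sit
  -- on edges inside `X` and no other edge repeats them.
  grow : IsRainbow χ H → ∀ j → j < ∣ verts ∣ → Grown j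
  grow rainbow zero _ = record
    { X = ⁅ w ⁆ ; Q = ∅ ; root = x∈⁅x⁆ w
    ; X⊆ = λ v∈ → subst (_∈ verts) (sym (x∈⁅y⁆⇒x≡y w v∈)) (proj₂ (proj₁ connected))
    ; ∣X∣ = ∣⁅x⁆∣≡1 w ; ∣Q∣ = ∣⊥∣≡0 t ; used = λ c∈ → contradiction c∈ ∉⊥ }
    where w = proj₁ (proj₁ connected)
  grow rainbow (suc j) j<∣V∣
    with g ← grow rainbow j (ℕ.<⇒≤ j<∣V∣)
    with v , v∈ , v∉ ← outsider (Grown.X g) verts (subst (_< ∣ verts ∣) (sym (Grown.∣X∣ g)) j<∣V∣)
    with a , b , a∈ , b∉ , e ← crossing (Grown.X g) (proj₂ connected (Grown.X⊆ g (Grown.root g)) v∈) (Grown.root g) v∉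
    = record
    { X = X ∪ ⁅ b ⁆ ; Q = Q ∪ ⁅ colour (edge⇒~ e) ⁆ ; root = old root
    ; X⊆ = ∪⁅⁆⊆ X⊆ (edge⇒vert (edge-sym e))
    ; ∣X∣ = trans (∣p∪⁅x⁆∣≡1+∣p∣ X b∉) (cong suc ∣X∣)
    ; ∣Q∣ = trans (∣p∪⁅x⁆∣≡1+∣p∣ Q new) (cong suc ∣Q∣)
    ; used = λ c∈ → [ (λ c∈Q → let u , v , u∈ , v∈ , f = used c∈Q in u , v , old u∈ , old v∈ , f)
                    , (λ c∈⁅⁆ → a , b , old a∈ , x∈p∪q⁺ (inj₂ (x∈⁅x⁆ b)) , e , sym (x∈⁅y⁆⇒x≡y _ c∈⁅⁆)) ]′ (x∈p∪q⁻ Q _ c∈)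
    }
    where
    open Grown g
    old : ∀ {u} → u ∈ X → u ∈ X ∪ ⁅ b ⁆
    old = x∈p∪q⁺ ∘ inj₁
    new : colour (edge⇒~ e) ∉ Q
    new c∈Q with u , v , u∈ , v∈ , f , eq ← used c∈Q with rainbow f e eq
    ... | inj₁ (_ , refl) = b∉ v∈
    ... | inj₂ (refl , _) = b∉ u∈

  ∣verts∣≤1+colours : IsRainbow χ H → ∣ verts ∣ ≤ suc t
  ∣verts∣≤1+colours rainbow with ∣ verts ∣ in eq
  ... | zero  = z≤n
  ... | suc j = s≤s (subst (_≤ t) (Grown.∣Q∣ g) (∣p∣≤n (Grown.Q g)))
    where g = grow rainbow j (subst (j <_) (sym eq) (ℕ.n<1+n j))

  neighbour : ∀ {u v} → u ∈ verts → v ∈ verts → u ≢ v → ∃[ x ] u — x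
  neighbour u∈ v∈ u≢v with proj₂ connected u∈ v∈
  ... | ε     = contradiction refl u≢v
  ... | e ◅ _ = _ , e

vertex-≡ : ∀ {r n} {u v : Fin (r * n)} → quotient {r} n u ≡ quotient n v → remainder {r} n u ≡ remainder {r} n v → u ≡ v
vertex-≡ {r} {n} {u} {v} eq eq′ = trans (sym (combine-remQuot {r} n u)) (trans (cong₂ combine eq eq′) (combine-remQuot {r} n v))

-- A vertex of `S` has a neighbour in the tree, which independence puts outside `S`. So the tree has
-- at least `suc k` vertices, while `s` colours allow at most `suc s`.
independent⇒k≤ : ∀ {m k ℓ s} {G : Graph m} .{{_ : NonZero ℓ}} (S : Subset m) → ∣ S ∣ ≡ k → 2 ≤ k →
  (∀ {u v} → u ∈ S → v ∈ S → ¬ Graph._~_ G u v) → Achievable k ℓ G s → k ≤ s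
independent⇒k≤ {k = k@(suc (suc _))} {ℓ} {s} S ∣S∣≡k (s≤s (s≤s z≤n)) independent (χ , rc)
  with H , trees , _ ← rc S ∣S∣≡k
  with elt , elt-inj , elt∈S , _ ← enumerate S ∣S∣≡k
  with q ← fromℕ< (>-nonZero⁻¹ ℓ)
  with (connected , _) , S⊆ , rainbow ← trees q
  with z , e ← neighbour χ (H q) connected (S⊆ (elt∈S zero)) (S⊆ (elt∈S (suc zero))) (λ eq → contradiction (elt-inj eq) λ ())
  = s≤s⁻¹ (begin
      suc k                 ≡⟨ cong suc ∣S∣≡k ⟨
      suc ∣ S ∣             ≡⟨ ∣p∪⁅x⁆∣≡1+∣p∣ S (λ z∈S → independent (elt∈S zero) z∈S (edge⇒~ (H q) e)) ⟨
      ∣ S ∪ ⁅ z ⁆ ∣         ≤⟨ p⊆q⇒∣p∣≤∣q∣ (∪⁅⁆⊆ S⊆ (edge⇒vert (H q) (edge-sym (H q) e))) ⟩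
      ∣ verts (H q) ∣       ≤⟨ ∣verts∣≤1+colours χ (H q) connected rainbow ⟩
      suc s                 ∎)
  where
  open ℕ.≤-Reasoning
  open Subgraph

achievable⇒k≤ : ∀ {k ℓ r n s} .{{_ : NonZero ℓ}} .{{_ : NonZero r}} → 2 ≤ k → k ≤ n → Achievable k ℓ K[ r × n ] s → k ≤ s
achievable⇒k≤ {k} {ℓ} {r} {n} 2≤k k≤n = independent⇒k≤ (image f) (∣image∣ f f-inj) 2≤k independent
  where
  i₀ : Fin r
  i₀ = fromℕ< (>-nonZero⁻¹ r)
  f : Fin k → Fin (r * n)
  f j = combine i₀ (inject≤ j k≤n)
  f-inj : Injective _≡_ _≡_ f
  f-inj eq = inject≤-injective k≤n k≤n _ _ (proj₂ (combine-injective i₀ _ i₀ _ eq))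
  class-f : ∀ {u} → u ∈ image f → quotient {r} n u ≡ i₀
  class-f u∈ with j , refl ← ∈-image⁻ f u∈ = cong proj₁ (remQuot-combine i₀ _)
  independent : ∀ {u v} → u ∈ image f → v ∈ image f → ¬ Graph._~_ K[ r × n ] u v
  independent {u} {v} u∈ v∈ u~v = K-adj⁻ r n {u} {v} u~v (trans (class-f {u} u∈) (sym (class-f {v} v∈)))

-- A balanced set and the edges inside it

2*C2 : ∀ r → 2 * (suc r C 2) ≡ suc r * r
2*C2 zero    = refl
2*C2 (suc r) = begin
  2 * (suc (suc r) C 2)            ≡⟨ cong (2 *_) (nCk+nC[k+1]≡[n+1]C[k+1] (suc r) 1) ⟨
  2 * (suc r C 1 + suc r C 2)      ≡⟨ cong (λ x → 2 * (x + suc r C 2)) (nC1≡n (suc r)) ⟩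
  2 * (suc r + suc r C 2)          ≡⟨ ℕ.*-distribˡ-+ 2 (suc r) (suc r C 2) ⟩
  2 * suc r + 2 * (suc r C 2)      ≡⟨ cong (λ x → 2 * suc r + x) (2*C2 r) ⟩
  2 * suc r + suc r * r            ≡⟨ rearrange r ⟩
  suc (suc r) * suc r              ∎
  where
  open ≡-Reasoning
  rearrange : ∀ r → 2 * (1 + r) + (1 + r) * r ≡ (1 + (1 + r)) * (1 + r)
  rearrange = solve-∀

module Balanced (k r n : ℕ) .{{_ : NonZero r}} (k≤n : k ≤ n) where

  private
    class : Fin (r * n) → Fin r
    class = quotient n
    index : Fin (r * n) → Fin n
    index = remainder {r} n

  height<n : ∀ (j : Fin k) → toℕ j / r < n
  height<n j = ℕ.≤-<-trans (m/n≤m (toℕ j) r) (ℕ.<-≤-trans (toℕ<n j) k≤n)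

  -- Deals `k` vertices to the classes in turn, so each class receives between ⌊k/r⌋ and ⌈k/r⌉ of
  -- them.
  spread : Fin k → Fin (r * n)
  spread j = combine (fromℕ< (m%n<n (toℕ j) r)) (fromℕ< (height<n j))

  class-spread : ∀ j → toℕ (class (spread j)) ≡ toℕ j % r
  class-spread j = trans (cong (toℕ ∘ proj₁) (remQuot-combine {r} _ _)) (toℕ-fromℕ< _)

  index-spread : ∀ j → toℕ (index (spread j)) ≡ toℕ j / r
  index-spread j = trans (cong (toℕ ∘ proj₂) (remQuot-combine {r} _ _)) (toℕ-fromℕ< _)

  spread-injective : Injective _≡_ _≡_ spread
  spread-injective {i} {j} eq = toℕ-injective (begin
    toℕ i                            ≡⟨ m≡m%n+[m/n]*n (toℕ i) r ⟩
    toℕ i % r + toℕ i / r * r        ≡⟨ cong₂ (λ x y → x + y * r) (trans (sym (class-spread i)) (trans (cong (toℕ ∘ class) eq) (class-spread j))) (trans (sym (index-spread i)) (trans (cong (toℕ ∘ index) eq) (index-spread j))) ⟩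
    toℕ j % r + toℕ j / r * r        ≡⟨ m≡m%n+[m/n]*n (toℕ j) r ⟨
    toℕ j                            ∎)
    where open ≡-Reasoning

  S : Subset (r * n)
  S = image spread

  index<⌈k/r⌉ : ∀ {v} → v ∈ S → toℕ (index v) < ⌈ k / r ⌉
  index<⌈k/r⌉ v∈S with j , refl ← ∈-image⁻ spread v∈S = begin-strict
    toℕ (index (spread j))  ≡⟨ index-spread j ⟩
    toℕ j / r               <⟨ ℕ.n<1+n _ ⟩
    1 + toℕ j / r           ≡⟨ ℕ.+-comm 1 _ ⟩
    toℕ j / r + 1           ≡⟨ cong (λ x → toℕ j / r + x) (n/n≡1 r) ⟨
    toℕ j / r + r / r       ≡⟨ +-distrib-/-∣ʳ (toℕ j) ∣-refl ⟨
    (toℕ j + r) / r         ≤⟨ /-monoˡ-≤ r j+r≤ ⟩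
    ⌈ k / r ⌉               ∎
    where
    open ℕ.≤-Reasoning
    -- The strict bound on `j` pays for the one by which `r` exceeds `r ∸ 1` in the ceiling.
    j+r≤ : toℕ j + r ≤ k + (r ∸ 1)
    j+r≤ = begin
      toℕ j + r                       ≡⟨ cong (λ x → toℕ j + x) (ℕ.suc-pred r) ⟨
      toℕ j + suc (pred r)   ≡⟨ ℕ.+-suc (toℕ j) _ ⟩
      suc (toℕ j) + pred r   ≤⟨ ℕ.+-mono-≤ (toℕ<n j) ℕ.≤-refl ⟩
      k + (r ∸ 1)            ∎

  ⌊k/r⌋≤n : k / r ≤ n
  ⌊k/r⌋≤n = ℕ.≤-trans (m/n≤m k r) k≤n

  low : Fin r → Fin (k / r) → Fin (r * n)
  low i x = combine i (inject≤ x ⌊k/r⌋≤n)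

  -- The first `k / r` rounds of dealing are complete: class `i` receives its vertex of round `x` at
  -- index `i + x * r`.
  low∈S : ∀ i x → low i x ∈ S
  low∈S i x = subst (_∈ S) (vertex-≡ (toℕ-injective class≡) (toℕ-injective index≡)) (∈-image⁺ spread j)
    where
    open ≡-Reasoning
    h = toℕ i + toℕ x * r
    h<k : h < k
    h<k = ℕ.<-≤-trans (ℕ.+-monoˡ-< (toℕ x * r) (toℕ<n i)) (ℕ.≤-trans (ℕ.*-monoˡ-≤ r (toℕ<n x)) (m/n*n≤m k r))
    j = fromℕ< h<k
    class≡ : toℕ (class (spread j)) ≡ toℕ (class (low i x))
    class≡ = begin
      toℕ (class (spread j))     ≡⟨ class-spread j ⟩
      toℕ j % r                  ≡⟨ cong (_% r) (toℕ-fromℕ< h<k) ⟩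
      h % r                      ≡⟨ [m+kn]%n≡m%n (toℕ i) (toℕ x) r ⟩
      toℕ i % r                  ≡⟨ m<n⇒m%n≡m (toℕ<n i) ⟩
      toℕ i                      ≡⟨ cong (toℕ ∘ proj₁) (remQuot-combine i _) ⟨
      toℕ (class (low i x))      ∎
    index≡ : toℕ (index (spread j)) ≡ toℕ (index (low i x))
    index≡ = begin
      toℕ (index (spread j))     ≡⟨ index-spread j ⟩
      toℕ j / r                  ≡⟨ cong (_/ r) (toℕ-fromℕ< h<k) ⟩
      h / r                      ≡⟨ +-distrib-/-∣ʳ (toℕ i) (n∣m*n (toℕ x)) ⟩
      toℕ i / r + toℕ x * r / r  ≡⟨ cong₂ _+_ (m<n⇒m/n≡0 (toℕ<n i)) (m*n/n≡m (toℕ x) r) ⟩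
      toℕ x                      ≡⟨ toℕ-inject≤ x _ ⟨
      toℕ (inject≤ x ⌊k/r⌋≤n)    ≡⟨ cong (toℕ ∘ proj₂) (remQuot-combine i _) ⟨
      toℕ (index (low i x))      ∎

-- Each of ℓ edge-disjoint graphs has `f` edges from class `i q` to other classes. Taken in both
-- directions they give `ℓ * f * 2` distinct arcs, while an arc is coded by an ordered pair of
-- distinct classes and two heights below `c`.
module ArcCount {V : Set} (r c ℓ f : ℕ) (class : V → Fin (suc r)) (height : V → ℕ)
    (separated : ∀ {u v} → class u ≡ class v → height u ≡ height v → u ≡ v)
    (E : Fin ℓ → V → V → Set) (E-sym : ∀ q {u v} → E q u v → E q v u)
    (E-disjoint : ∀ {q q′ u v} → E q u v → E q′ u v → q ≡ q′)
    (i : Fin ℓ → Fin (suc r)) (s z : Fin ℓ → Fin f → V)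
    (s—z : ∀ q x → E q (s q x) (z q x))
    (s-injective : ∀ q {x y} → s q x ≡ s q y → x ≡ y)
    (class-s : ∀ q x → class (s q x) ≡ i q) (class-z : ∀ q x → class (z q x) ≢ i q)
    (height-s : ∀ q x → height (s q x) < c) (height-z : ∀ q x → height (z q x) < c) where

  private
    Arc : Set
    Arc = ∃₂ λ u v → class u ≢ class v × height u < c × height v < c

    tail head : Arc → V
    tail (u , _) = u
    head (_ , v , _) = v

    arc : Fin ℓ → Fin f → Fin 2 → Arc
    arc q x zero    = s q x , z q x , (λ eq → class-z q x (trans (sym eq) (class-s q x))) , height-s q x , height-z q x
    arc q x (suc _) = z q x , s q x , (λ eq → class-z q x (trans eq (class-s q x))) , height-z q x , height-s q x

    arc-edge : ∀ q x o → E q (tail (arc q x o)) (head (arc q x o))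
    arc-edge q x zero    = s—z q x
    arc-edge q x (suc _) = E-sym q (s—z q x)

    -- Disjointness forces the same graph, and the direction shows in whether the tail lies in class
    -- `i q`.
    arc-injective : ∀ q x o q′ x′ o′ → tail (arc q x o) ≡ tail (arc q′ x′ o′) → head (arc q x o) ≡ head (arc q′ x′ o′) →
      (q , x , o) ≡ (q′ , x′ , o′)
    arc-injective q x o q′ x′ o′ t≡ h≡
      with refl ← E-disjoint (arc-edge q x o) (subst₂ (E q′) (sym t≡) (sym h≡) (arc-edge q′ x′ o′)) = go o o′ t≡ h≡
      where
      go : ∀ o o′ → tail (arc q x o) ≡ tail (arc q x′ o′) → head (arc q x o) ≡ head (arc q x′ o′) → (q , x , o) ≡ (q , x′ , o′)
      go zero       zero       t≡ _  = cong (λ x → q , x , zero) (s-injective q t≡)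
      go zero       (suc zero) t≡ _  = contradiction (trans (cong class (sym t≡)) (class-s q x)) (class-z q x′)
      go (suc zero) zero       t≡ _  = contradiction (trans (cong class t≡) (class-s q x′)) (class-z q x)
      go (suc zero) (suc zero) _  h≡ = cong (λ x → q , x , suc zero) (s-injective q h≡)

    code : Arc → Fin ((suc r * r) * (c * c))
    code (u , v , u≢v , u< , v<) = combine (combine (class u) (punchOut u≢v)) (combine (fromℕ< u<) (fromℕ< v<))

    fromℕ<-inj : ∀ {a b} (a< : a < c) (b< : b < c) → fromℕ< a< ≡ fromℕ< b< → a ≡ b
    fromℕ<-inj a< b< eq = trans (sym (toℕ-fromℕ< a<)) (trans (cong toℕ eq) (toℕ-fromℕ< b<))

    punchOut-≡ : ∀ {i i′ j j′ : Fin (suc r)} (p : i ≢ j) (p′ : i′ ≢ j′) → i ≡ i′ → punchOut p ≡ punchOut p′ → j ≡ j′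
    punchOut-≡ p p′ refl = punchOut-injective p p′

    code-injective : ∀ a b → code a ≡ code b → tail a ≡ tail b × head a ≡ head b
    code-injective (u , v , u≢v , u< , v<) (u′ , v′ , u≢v′ , u<′ , v<′) eq
      with classes , heights ← combine-injective {suc r * r} {c * c} _ _ _ _ eq
      with cu , po ← combine-injective {suc r} {r} _ _ _ _ classes
      with hu , hv ← combine-injective {c} {c} _ _ _ _ heights
      = separated cu (fromℕ<-inj u< u<′ hu) , separated (punchOut-≡ u≢v u≢v′ cu po) (fromℕ<-inj v< v<′ hv)

    label : Fin (ℓ * f * 2) → Fin ℓ × Fin f × Fin 2
    label y = let qx , o = remQuot {ℓ * f} 2 y ; q , x = remQuot {ℓ} f qx in q , x , o

    unlabel : ∀ y → let q , x , o = label y in combine (combine q x) o ≡ y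
    unlabel y = trans (cong (λ qx → combine qx (proj₂ (remQuot {ℓ * f} 2 y))) (combine-remQuot {ℓ} f (proj₁ (remQuot {ℓ * f} 2 y)))) (combine-remQuot {ℓ * f} 2 y)

    label-injective : Injective _≡_ _≡_ label
    label-injective {y} {y′} eq = trans (sym (unlabel y)) (trans (cong (λ (q , x , o) → combine (combine q x) o) eq) (unlabel y′))

    arcOf : Fin (ℓ * f * 2) → Arc
    arcOf y = let q , x , o = label y in arc q x o

  bound : ℓ * f ≤ (suc r C 2) * c ^ 2
  bound = ℕ.*-cancelʳ-≤ (ℓ * f) _ 2 (begin
    ℓ * f * 2                    ≤⟨ injective⇒≤ {f = code ∘ arcOf} (λ {y} {y′} eq → let t≡ , h≡ = code-injective (arcOf y) (arcOf y′) eq in label-injective (arc-injective _ _ _ _ _ _ t≡ h≡)) ⟩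
    suc r * r * (c * c)          ≡⟨ cong (_* (c * c)) (2*C2 r) ⟨
    2 * (suc r C 2) * (c * c)    ≡⟨ rearrange (suc r C 2) c ⟩
    (suc r C 2) * c ^ 2 * 2      ∎)
    where
    open ℕ.≤-Reasoning
    rearrange : ∀ x c → 2 * x * (c * c) ≡ x * (c * (c * 1)) * 2
    rearrange = solve-∀

-- With k colours a tree has at most one vertex outside S; if that vertex lies
-- in class i then each vertex of S in class i needs an edge inside S.
edgeBound : ∀ {m k ℓ r f c} {G : Graph m} (S : Subset m) → ∣ S ∣ ≡ k →
  (class : Fin m → Fin (suc (suc r))) → (∀ {u v} → Graph._~_ G u v → class u ≢ class v) →
  (height : Fin m → ℕ) → (∀ {u v} → class u ≡ class v → height u ≡ height v → u ≡ v) →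
  (∀ {v} → v ∈ S → height v < c) →
  (low : Fin (suc (suc r)) → Fin f → Fin m) → (∀ i x → class (low i x) ≡ i) → (∀ i → Injective _≡_ _≡_ (low i)) →
  (∀ i x → low i x ∈ S) → Achievable k ℓ G k → ℓ * f ≤ (suc (suc r) C 2) * c ^ 2
edgeBound {m} {k} {ℓ} {r} {f} {c} {G} S ∣S∣≡k class adj⇒≢ height separated height< low class-low low-inj low∈S (χ , rc)
  with H , trees , disjoint ← rc S ∣S∣≡k
  = ArcCount.bound (suc r) c ℓ f class height separated
    (λ q u v → T (edge (H q) u v)) (λ q → edge-sym (H q)) E-disjoint
    i (λ q → low (i q)) z s—z (λ q → low-inj (i q)) (λ q → class-low (i q)) class-z≢
    (λ q x → height< (low∈S (i q) x)) (λ q x → height< (z∈S q x))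
  where
  open Subgraph
  E-disjoint : ∀ {q q′ u v} → T (edge (H q) u v) → T (edge (H q′) u v) → q ≡ q′
  E-disjoint {q} {q′} {u} {v} e e′ = decidable-stable (q ≟ q′) λ q≢q′ → proj₁ (disjoint q q′ q≢q′) u v (e , e′)
  connected : ∀ q → Connected (H q)
  connected q = proj₁ (proj₁ (trees q))
  S⊆ : ∀ q → S ⊆ verts (H q)
  S⊆ q = proj₁ (proj₂ (trees q))
  extraClass : ∀ q → ∃[ i ] (∀ {v} → v ∈ verts (H q) → v ∉ S → class v ≡ i)
  extraClass q with any? (λ v → (v ∈? verts (H q)) ×-dec ¬? (v ∈? S))
  -- With no vertex outside `S` the condition is vacuous and any class serves.
  ... | no ∄v = zero , λ v∈ v∉ → contradiction (_ , v∈ , v∉) ∄v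
  ... | yes (u , u∈ , u∉) = class u , λ {v} v∈ v∉ → cong class (decidable-stable (v ≟ u) λ v≢u → ℕ.<⇒≱ (ℕ.n<1+n (suc k)) (begin
      suc (suc k)                 ≡⟨ cong (λ x → suc (suc x)) ∣S∣≡k ⟨
      suc (suc ∣ S ∣)             ≡⟨ cong suc (∣p∪⁅x⁆∣≡1+∣p∣ S u∉) ⟨
      suc ∣ S ∪ ⁅ u ⁆ ∣           ≡⟨ ∣p∪⁅x⁆∣≡1+∣p∣ (S ∪ ⁅ u ⁆) ([ v∉ , v≢u ∘ x∈⁅y⁆⇒x≡y u ]′ ∘ x∈p∪q⁻ S _) ⟨
      ∣ (S ∪ ⁅ u ⁆) ∪ ⁅ v ⁆ ∣     ≤⟨ p⊆q⇒∣p∣≤∣q∣ (∪⁅⁆⊆ (∪⁅⁆⊆ (S⊆ q) u∈) v∈) ⟩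
      ∣ verts (H q) ∣             ≤⟨ ∣verts∣≤1+colours χ (H q) (connected q) (proj₂ (proj₂ (trees q))) ⟩
      suc k                       ∎))
      where open ℕ.≤-Reasoning
  i : Fin ℓ → Fin (suc (suc r))
  i q = proj₁ (extraClass q)
  partner : ∀ q x → ∃[ z ] T (edge (H q) (low (i q) x) z)
  -- A vertex of `S` in another class serves as a second vertex of the tree, so that connectedness
  -- gives an edge.
  partner q x = neighbour χ (H q) (connected q) (S⊆ q (low∈S (i q) x)) (S⊆ q (low∈S j x)) λ eq →
    punchInᵢ≢i (i q) zero (trans (sym (class-low j x)) (trans (cong class (sym eq)) (class-low (i q) x)))
    where j = punchIn (i q) zero
  z : Fin ℓ → Fin f → Fin m
  z q x = proj₁ (partner q x)
  s—z : ∀ q x → T (edge (H q) (low (i q) x) (z q x))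
  s—z q x = proj₂ (partner q x)
  class-z≢ : ∀ q x → class (z q x) ≢ i q
  class-z≢ q x eq = adj⇒≢ (edge⇒~ (H q) (s—z q x)) (trans (class-low (i q) x) (sym eq))
  z∈S : ∀ q x → z q x ∈ S
  z∈S q x = decidable-stable (z q x ∈? S) λ z∉ →
    class-z≢ q x (proj₂ (extraClass q) (edge⇒vert (H q) (edge-sym (H q) (s—z q x))) z∉)

achievable-k⇒edgeBound : ∀ {k ℓ r n} .{{_ : NonZero r}} → 3 ≤ r → k ≤ n → Achievable k ℓ K[ r × n ] k →
  ℓ * (k / r) ≤ (r C 2) * ⌈ k / r ⌉ ^ 2
achievable-k⇒edgeBound {k} {ℓ} {r@(suc (suc _))} {n} (s≤s (s≤s _)) k≤n =
  edgeBound S (∣image∣ spread spread-injective) (quotient {r} n) (λ {u} {v} → K-adj⁻ r n {u} {v})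
    (toℕ ∘ remainder {r} n) (λ {u} {v} c≡ h≡ → vertex-≡ {r} {n} {u} {v} c≡ (toℕ-injective h≡))
    (λ {v} → index<⌈k/r⌉ {v}) low (λ i x → cong proj₁ (remQuot-combine {r} {n} i _))
    (λ i eq → inject≤-injective _ _ _ _ (proj₂ (combine-injective i _ i _ eq))) low∈S
  where open Balanced k r n k≤n

>threshold⇒ : ∀ ℓ a d .{{_ : NonZero d}} → (+ ℓ ℚᵘ./ 1) ℚᵘ.> (+ a ℚᵘ./ d) → a < ℓ * d
>threshold⇒ ℓ a (suc d) (*<* a*1<ℓ*d) = ℤ.drop‿+<+ (subst₂ ℤ._<_ (ℤ.*-identityʳ (+ a)) (sym (ℤ.pos-* ℓ (suc d))) a*1<ℓ*d)

-- Exhaustive search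

Searchable : Set → Set₁
Searchable A = ∀ {P : A → Set} → (∀ a → Dec (P a)) → Dec (∃ P)

search-Bool : Searchable Bool
search-Bool P? = map′ [ true ,_ , false ,_ ]′ (λ { (true , p) → inj₁ p ; (false , p) → inj₂ p }) (P? true ⊎-dec P? false)

search-Vec : ∀ {A} → Searchable A → ∀ n → Searchable (Vec A n)
search-Vec search zero    P? = map′ ([] ,_) (λ { ([] , p) → p }) (P? [])
search-Vec search (suc n) P? = map′ (λ (a , as , p) → a ∷ as , p) (λ { (a ∷ as , p) → a , as , p })
  (search λ a → search-Vec search n λ as → P? (a ∷ as))

search-× : ∀ {A B} → Searchable A → Searchable B → Searchable (A × B)
search-× search search′ P? = map′ (λ (a , b , p) → (a , b) , p) (λ ((a , b) , p) → a , b , p)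
  (search λ a → search′ λ b → P? (a , b))

search-∀ : ∀ {A} → Searchable A → {P : A → Set} → (∀ a → Dec (P a)) → Dec (∀ a → P a)
search-∀ search P? = map′ (λ ∄ a → decidable-stable (P? a) λ ¬p → ∄ (a , ¬p)) (λ ∀p (a , ¬p) → ¬p (∀p a)) (¬? (search λ a → ¬? (P? a)))

T-∀? : ∀ b {P : T b → Set} → (∀ e → Dec (P e)) → Dec (∀ e → P e)
T-∀? true  P? = map′ (λ p _ → p) (λ f → f tt) (P? tt)
T-∀? false P? = yes λ ()

-- Saturates the set of vertices reached from `u`. The fuel bounds the number of vertices still
-- missing, so running out of it leaves no vertex to add.
star? : ∀ {m} {R : Fin m → Fin m → Set} → (∀ a b → Dec (R a b)) → ∀ u v → Dec (Star R u v)
star? {m} {R} R? u v with close m ⁅ u ⁆ (x∈⁅x⁆ u) (λ x∈ → subst (Star R u) (sym (x∈⁅y⁆⇒x≡y u x∈)) ε) (ℕ.m≤m+n m _)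
  where
  close : ∀ fuel (X : Subset m) → u ∈ X → (∀ {x} → x ∈ X → Star R u x) → m ≤ fuel + ∣ X ∣ →
    ∃[ X ] u ∈ X × (∀ {x} → x ∈ X → Star R u x) × (∀ {a b} → a ∈ X → b ∉ X → ¬ R a b)
  close fuel X u∈X reach m≤ with any? (λ a → any? (λ b → (a ∈? X) ×-dec (¬? (b ∈? X) ×-dec R? a b)))
  ... | no ∄ab = X , u∈X , reach , λ a∈ b∉ ab → ∄ab (_ , _ , a∈ , b∉ , ab)
  ... | yes (a , b , a∈ , b∉ , ab) with fuel
  ...   | zero = contradiction (∣p∣≤n (X ∪ ⁅ b ⁆)) (ℕ.<⇒≱ (subst (m <_) (sym (∣p∪⁅x⁆∣≡1+∣p∣ X b∉)) (s≤s m≤)))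
  ...   | suc fuel = close fuel (X ∪ ⁅ b ⁆) (x∈p∪q⁺ (inj₁ u∈X))
            (λ x∈ → [ reach , (λ x∈⁅b⁆ → subst (Star R u) (sym (x∈⁅y⁆⇒x≡y b x∈⁅b⁆)) (reach a∈ ◅◅ (ab ◅ ε))) ]′ (x∈p∪q⁻ X _ x∈))
            (subst (m ≤_) (trans (sym (ℕ.+-suc fuel ∣ X ∣)) (cong (λ x → fuel + x) (sym (∣p∪⁅x⁆∣≡1+∣p∣ X b∉)))) m≤)
... | X , u∈X , reach , closed with v ∈? X
...   | yes v∈X = yes (reach v∈X)
...   | no v∉X  = no λ walk → let _ , _ , a∈ , b∉ , ab = crossing X walk u∈X v∉X in closed a∈ b∉ ab

-- Deciding the properties of subgraphs and colourings

module _ {m} {G : Graph m} where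
  open Graph G
  open Subgraph

  connected? : (H : Subgraph G) → Dec (Connected H)
  connected? H = nonempty? (verts H) ×-dec
    map′ (λ f {u} {v} → f u v) (λ f u v → f)
      (all? λ u → all? λ v → (u ∈? verts H) →-dec ((v ∈? verts H) →-dec star? (λ a b → T? (edge H a b)) u v))

  CycleOf : (H : Subgraph G) (p : ℕ) → Vec (Fin m) (3 + p) → Set
  CycleOf H p c = (∀ i j → lookup c i ≡ lookup c j → i ≡ j) ×
                  (∀ i → T (edge H (lookup c (inject₁ i)) (lookup c (suc i)))) ×
                  T (edge H (lookup c (fromℕ (2 + p))) (lookup c zero))

  -- The `3 + p` vertices of a cycle are distinct elements of `Fin m`, so only `p` below `m` need be
  -- searched.
  cycle? : (H : Subgraph G) → Dec (Cycle H)
  cycle? H = map′ to from (any? {m} λ p → search-Vec any? (3 + toℕ p) λ c →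
      (all? λ i → all? λ j → (lookup c i ≟ lookup c j) →-dec (i ≟ j)) ×-dec
      ((all? λ i → T? (edge H (lookup c (inject₁ i)) (lookup c (suc i)))) ×-dec
       T? (edge H (lookup c (fromℕ (2 + toℕ p))) (lookup c zero))))
    where
    to : ∃ (λ (p : Fin m) → ∃ (CycleOf H (toℕ p))) → Cycle H
    to (p , c , inj , step , close) = record { p = toℕ p ; c = lookup c ; injective = inj _ _ ; step = step ; close = close }
    from : Cycle H → ∃ (λ (p : Fin m) → ∃ (CycleOf H (toℕ p)))
    from cyc = fromℕ< p<m , subst (∃ ∘ CycleOf H) (sym (toℕ-fromℕ< p<m)) (tabulate c ,
        (λ i j eq → injective (trans (sym (lookup∘tabulate c i)) (trans eq (lookup∘tabulate c j)))) ,
        (λ i → subst₂ (λ u v → T (edge H u v)) (sym (lookup∘tabulate c (inject₁ i))) (sym (lookup∘tabulate c (suc i))) (step i)) ,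
        subst₂ (λ u v → T (edge H u v)) (sym (lookup∘tabulate c (fromℕ (2 + p)))) (sym (lookup∘tabulate c zero)) close)
      where
      open Cycle cyc
      p<m : p < m
      p<m = ℕ.≤-trans (s≤s (ℕ.m≤n+m p 2)) (injective⇒≤ injective)

  rainbowTreeOn? : ∀ {t} (χ : EdgeColouring G t) S H → Dec (IsRainbowTreeOn χ S H)
  rainbowTreeOn? χ S H = (connected? H ×-dec ¬? (cycle? H)) ×-dec ((S ⊆? verts H) ×-dec
    map′ (λ f {u} {v} {x} {y} → f u v x y) (λ f u v x y → f) (all? λ u → all? λ v → all? λ x → all? λ y →
      T-∀? (edge H u v) λ e → T-∀? (edge H x y) λ f →
        (colour (edge⇒~ H e) ≟ colour (edge⇒~ H f)) →-dec
        (((u ≟ x) ×-dec (v ≟ y)) ⊎-dec ((u ≟ y) ×-dec (v ≟ x)))))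
    where open EdgeColouring χ

  internallyDisjoint? : ∀ {ℓ} S (H : Fin ℓ → Subgraph G) → Dec (InternallyDisjoint S H)
  internallyDisjoint? S H = all? λ i → all? λ j → ¬? (i ≟ j) →-dec
    ((all? λ u → all? λ v → ¬? (T? (edge (H i) u v) ×-dec T? (edge (H j) u v))) ×-dec
     ≡-dec Bool._≟_ (verts (H i) ∩ verts (H j)) S)

  -- Equality of the edge relations as relations. A subgraph also holds functions and proofs, so
  -- decoding its code is only shown to return it up to `_≋_`.
  record _≋_ (H H′ : Subgraph G) : Set where
    field
      verts≡ : verts H ≡ verts H′
      edge⇒  : ∀ {u v} → T (edge H u v) → T (edge H′ u v)
      edge⇐  : ∀ {u v} → T (edge H′ u v) → T (edge H u v)

  open _≋_

  Connected-resp : ∀ {H H′} → H ≋ H′ → Connected H → Connected H′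
  Connected-resp {H} {H′} H≋ ((w , w∈) , walk) = (w , subst (w ∈_) (verts≡ H≋) w∈) ,
    λ {u} {v} u∈ v∈ → Star.map (edge⇒ H≋) (walk (subst (u ∈_) (sym (verts≡ H≋)) u∈) (subst (v ∈_) (sym (verts≡ H≋)) v∈))

  Cycle-resp : ∀ {H H′} → H ≋ H′ → Cycle H′ → Cycle H
  Cycle-resp H≋ cyc = record { p = p ; c = c ; injective = injective ; step = λ i → edge⇐ H≋ (step i) ; close = edge⇐ H≋ close }
    where open Cycle cyc

  IsRainbowTreeOn-resp : ∀ {t} {χ χ′ : EdgeColouring G t} {S H H′} →
    (∀ {u v} (e : u ~ v) → EdgeColouring.colour χ e ≡ EdgeColouring.colour χ′ e) → H ≋ H′ →
    IsRainbowTreeOn χ S H → IsRainbowTreeOn χ′ S H′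
  IsRainbowTreeOn-resp {χ = χ} {χ′} {S} {H} {H′} χ≗ H≋ ((connected , acyclic) , S⊆ , rainbow) =
    (Connected-resp H≋ connected , acyclic ∘ Cycle-resp H≋) , (λ {x} → subst (x ∈_) (verts≡ H≋) ∘ S⊆) ,
    λ {u} {v} {x} {y} e f eq → rainbow (edge⇐ H≋ e) (edge⇐ H≋ f) (trans (same e) (trans eq (sym (same f))))
    where
    same : ∀ {u v} (e : T (edge H′ u v)) →
      EdgeColouring.colour χ (edge⇒~ H (edge⇐ H≋ e)) ≡ EdgeColouring.colour χ′ (edge⇒~ H′ e)
    same {u} {v} e = trans (cong (EdgeColouring.colour χ) (T-irrelevant (edge⇒~ H (edge⇐ H≋ e)) (edge⇒~ H′ e))) (χ≗ _)

  InternallyDisjoint-resp : ∀ {ℓ S} {H H′ : Fin ℓ → Subgraph G} → (∀ i → H i ≋ H′ i) → InternallyDisjoint S H → InternallyDisjoint S H′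
  InternallyDisjoint-resp H≋ disjoint i j i≢j =
    (λ u v (e , e′) → proj₁ (disjoint i j i≢j) u v (edge⇐ (H≋ i) e , edge⇐ (H≋ j) e′)) ,
    trans (sym (cong₂ _∩_ (verts≡ (H≋ i)) (verts≡ (H≋ j)))) (proj₂ (disjoint i j i≢j))

  Code : Set
  Code = Subset m × Vec (Vec Bool m) m

  -- Restricting to edges of `G` with both ends in `V` and symmetrising turns an arbitrary matrix
  -- into a valid subgraph, so the search can run over all matrices.
  decodeEdge : Code → Fin m → Fin m → Set
  decodeEdge (V , E) u v = u ~ v × u ∈ V × v ∈ V × (T (lookup (lookup E u) v) ⊎ T (lookup (lookup E v) u))

  decodeEdge? : ∀ c u v → Dec (decodeEdge c u v)
  decodeEdge? (V , E) u v = T? (adj u v) ×-dec ((u ∈? V) ×-dec ((v ∈? V) ×-dec (T? _ ⊎-dec T? _)))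

  decode : Code → Subgraph G
  decode c = record
    { verts     = proj₁ c
    ; edge      = λ u v → ⌊ decodeEdge? c u v ⌋
    ; edge-sym  = λ {u} {v} e → let u~v , u∈ , v∈ , E = toWitness {a? = decodeEdge? c u v} e in
        fromWitness {a? = decodeEdge? c v u} (symm u~v , v∈ , u∈ , swap E)
    ; edge⇒~    = λ {u} {v} e → proj₁ (toWitness {a? = decodeEdge? c u v} e)
    ; edge⇒vert = λ {u} {v} e → proj₁ (proj₂ (toWitness {a? = decodeEdge? c u v} e))
    }

  encode : Subgraph G → Code
  encode H = verts H , tabulate λ u → tabulate λ v → edge H u v

  decode-encode : ∀ H → H ≋ decode (encode H)
  decode-encode H = record
    { verts≡ = refl
    ; edge⇒  = λ {u} {v} e → fromWitness {a? = decodeEdge? (encode H) u v}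
        (edge⇒~ H e , edge⇒vert H e , edge⇒vert H (edge-sym H e) , inj₁ (subst T (sym (entry u v)) e))
    ; edge⇐  = λ {u} {v} e → [ subst T (entry u v) , edge-sym H ∘ subst T (entry v u) ]′
        (proj₂ (proj₂ (proj₂ (toWitness {a? = decodeEdge? (encode H) u v} e))))
    }
    where
    entry : ∀ u v → lookup (lookup (proj₂ (encode H)) u) v ≡ edge H u v
    entry u v = trans (cong (λ row → lookup row v) (lookup∘tabulate _ u)) (lookup∘tabulate (edge H u) v)

  search-Code : Searchable Code
  search-Code = search-× (search-Vec search-Bool m) (search-Vec (search-Vec search-Bool m) m)

  rainbowColouring? : ∀ {t} k ℓ (χ : EdgeColouring G t) → Dec (IsRainbowColouring k ℓ χ)
  rainbowColouring? k ℓ χ = search-∀ (search-Vec search-Bool m) λ S → (∣ S ∣ ℕ.≟ k) →-dec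
    map′ (λ (cs , trees , disjoint) → decode ∘ lookup cs , trees , disjoint)
         (λ (H , trees , disjoint) → tabulate (encode ∘ H) ,
            (λ i → IsRainbowTreeOn-resp {χ = χ} {χ} (λ _ → refl) (coded H i) (trees i)) , InternallyDisjoint-resp (coded H) disjoint)
         (search-Vec search-Code ℓ λ cs →
           (all? λ i → rainbowTreeOn? χ S (decode (lookup cs i))) ×-dec internallyDisjoint? S (decode ∘ lookup cs))
    where
    coded : ∀ (H : Fin ℓ → Subgraph G) i → H i ≋ decode (lookup (tabulate (encode ∘ H)) i)
    coded H i = subst (λ c → H i ≋ decode c) (sym (lookup∘tabulate (encode ∘ H) i)) (decode-encode (H i))

  IsRainbowColouring-resp : ∀ {t k ℓ} {χ χ′ : EdgeColouring G t} →
    (∀ {u v} (e : u ~ v) → EdgeColouring.colour χ e ≡ EdgeColouring.colour χ′ e) →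
    IsRainbowColouring k ℓ χ → IsRainbowColouring k ℓ χ′
  IsRainbowColouring-resp {χ = χ} {χ′} χ≗ rc S ∣S∣≡k = let H , trees , disjoint = rc S ∣S∣≡k in
    H , (λ i → IsRainbowTreeOn-resp {χ = χ} {χ′} χ≗ (record { verts≡ = refl ; edge⇒ = id ; edge⇐ = id }) (trees i)) , disjoint

  -- Reads a matrix on one side of the diagonal only, so that every matrix decodes to a symmetric
  -- colouring.
  sorted : ∀ {A : Set} → (Fin m → Fin m → A) → Fin m → Fin m → A
  sorted f u v with toℕ u ≤? toℕ v
  ... | yes _ = f u v
  ... | no _  = f v u

  sorted-sym : ∀ {A : Set} (f : Fin m → Fin m → A) u v → sorted f u v ≡ sorted f v u
  sorted-sym f u v with toℕ u ≤? toℕ v | toℕ v ≤? toℕ u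
  ... | yes u≤v | yes v≤u with refl ← toℕ-injective (ℕ.≤-antisym u≤v v≤u) = refl
  ... | yes _   | no _    = refl
  ... | no _    | yes _   = refl
  ... | no u≰v  | no v≰u  = contradiction (ℕ.≰⇒≥ u≰v) v≰u

  decodeColouring : ∀ {t} → Vec (Vec (Fin t) m) m → EdgeColouring G t
  decodeColouring M = record
    { colour     = λ {u} {v} _ → sorted (λ u v → lookup (lookup M u) v) u v
    ; colour-sym = λ {u} {v} _ _ → sorted-sym _ u v
    }

  module _ {t} (χ : EdgeColouring G (suc t)) where
    open EdgeColouring χ

    -- Extends the colouring to non-edges by `zero`; this default is why the number of colours has
    -- the form `suc t`.
    paint : Fin m → Fin m → Fin (suc t)
    paint u v with T? (adj u v)
    ... | yes e = colour e
    ... | no _  = zero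

    paint-~ : ∀ {u v} (e : u ~ v) → paint u v ≡ colour e
    paint-~ {u} {v} e with T? (adj u v)
    ... | yes e′ = cong colour (T-irrelevant e′ e)
    ... | no ¬e  = contradiction e ¬e

    encodeColouring : Vec (Vec (Fin (suc t)) m) m
    encodeColouring = tabulate λ u → tabulate (paint u)

    entry : ∀ u v → lookup (lookup encodeColouring u) v ≡ paint u v
    entry u v = trans (cong (λ row → lookup row v) (lookup∘tabulate _ u)) (lookup∘tabulate (paint u) v)

    decode-encodeColouring : ∀ {u v} (e : u ~ v) → colour e ≡ EdgeColouring.colour (decodeColouring encodeColouring) e
    decode-encodeColouring {u} {v} e with toℕ u ≤? toℕ v
    ... | yes _ = sym (trans (entry u v) (paint-~ e))
    ... | no _  = trans (colour-sym e (symm e)) (sym (trans (entry v u) (paint-~ (symm e))))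

achievable? : ∀ {m} k ℓ (G : Graph m) s → Dec (Achievable k ℓ G (suc s))
achievable? {m} k ℓ G s = map′ (λ (M , rc) → decodeColouring M , rc)
  (λ (χ , rc) → encodeColouring χ , IsRainbowColouring-resp {G = G} {k = k} {ℓ} {χ} {decodeColouring (encodeColouring χ)} (decode-encodeColouring χ) rc)
  (search-Vec (search-Vec any? m) m λ M → rainbowColouring? k ℓ (decodeColouring M))

-- Combining the bounds in the three cases

theorem3p1 : ∀ (k ℓ r : ℕ) .{{_ : NonZero k}} .{{_ : NonZero ℓ}} .{{_ : NonZero r}} →
    k ≥ 3 → r ≥ 3 →
    ∃[ N ] N > 0 × (∀ (n : ℕ) → n ≥ N →
    (k < r → rx[ k , ℓ ] K[ r × n ] ≈ k) ×
    ((k≥r : k ≥ r) → (+ ℓ ℚᵘ./ 1) ℚᵘ.≤ threshold k r k≥r →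
    (rx[ k , ℓ ] K[ r × n ] ≈ k) ⊎ (rx[ k , ℓ ] K[ r × n ] ≈ (k + 1))) ×
    ((k≥r : k ≥ r) → (+ ℓ ℚᵘ./ 1) ℚᵘ.> threshold k r k≥r →
    rx[ k , ℓ ] K[ r × n ] ≈ (k + 1)))
theorem3p1 k@(suc k′) ℓ r@(suc (suc _)) k≥3 r≥3@(s≤s (s≤s _)) =
  -- `N₁` and `N₂` provide hubs for stars and for double stars; `k` lets one class hold `k` vertices
  -- and makes the sum positive.
  N₁ + N₂ + k , ℕ.m≤n⇒m≤o+n (N₁ + N₂) (s≤s z≤n) , λ n n≥N →
    let star   = proj₂ stars n (ℕ.≤-trans (ℕ.≤-trans (ℕ.m≤m+n N₁ N₂) (ℕ.m≤m+n (N₁ + N₂) k)) n≥N)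
        dstar  = proj₂ doubleStars n (ℕ.≤-trans (ℕ.≤-trans (ℕ.m≤n+m N₂ N₁) (ℕ.m≤m+n (N₁ + N₂) k)) n≥N)
        k≤n    = ℕ.≤-trans (ℕ.m≤n+m k (N₁ + N₂)) n≥N
        lower  = λ s → achievable⇒k≤ {k} {ℓ} {r} {n} {s} (ℕ.<⇒≤ k≥3) k≤n
        upper  = achievable-doubleStar r n (proj₁ dstar) (proj₁ (proj₂ dstar)) (proj₂ (proj₂ dstar)) zero (suc zero) λ ()
        ¬k⇒k+1 = exactly-k+1 lower upper
    in (λ k<r → achievable-star r n (proj₁ star) (proj₁ (proj₂ star)) (proj₂ (proj₂ star)) k<r , lower) ,
       (λ _ _ → dichotomy lower ¬k⇒k+1) ,
       λ k≥r ℓ> → ¬k⇒k+1 λ achievable-k → ℕ.<⇒≱ (aboveThreshold k≥r ℓ>) (achievable-k⇒edgeBound {k} {ℓ} {r} {n} r≥3 k≤n achievable-k)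
  where
  -- Stars spend all `suc k′` colours on the edges at `S`; double stars have `suc k` colours and
  -- keep `zero` for the centre edge.
  stars = hubColouring k ℓ r k′ id
  doubleStars = hubColouring k ℓ r k suc
  N₁ N₂ : ℕ
  N₁ = proj₁ stars
  N₂ = proj₁ doubleStars
  exactly-k+1 : ∀ {m} {G : Graph m} → (∀ s → Achievable k ℓ G s → k ≤ s) → Achievable k ℓ G (suc k) →
    ¬ Achievable k ℓ G k → rx[ k , ℓ ] G ≈ (k + 1)
  exactly-k+1 {G = G} lower upper ¬achievable-k = subst (rx[ k , ℓ ] G ≈_) (ℕ.+-comm 1 k) (upper , λ s achievable →
    ℕ.≤∧≢⇒< (lower s achievable) λ { refl → ¬achievable-k achievable })
  -- The lower and upper bounds leave two values, and the search over all colourings with `k`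
  -- colours decides between them.
  dichotomy : ∀ {m} {G : Graph m} → (∀ s → Achievable k ℓ G s → k ≤ s) → (¬ Achievable k ℓ G k → rx[ k , ℓ ] G ≈ (k + 1)) →
    (rx[ k , ℓ ] G ≈ k) ⊎ (rx[ k , ℓ ] G ≈ (k + 1))
  dichotomy {G = G} lower ¬k⇒k+1 with achievable? k ℓ G k′
  ... | yes a = inj₁ (a , lower)
  ... | no ¬a = inj₂ (¬k⇒k+1 ¬a)
  aboveThreshold : (k≥r : k ≥ r) → (+ ℓ ℚᵘ./ 1) ℚᵘ.> threshold k r k≥r → (r C 2) * ⌈ k / r ⌉ ^ 2 < ℓ * (k / r)
  aboveThreshold k≥r = >threshold⇒ ℓ _ (k / r) {{>-nonZero (m≥n⇒m/n>0 k≥r)}}
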